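{- Let $\nu=(\nu_1,\dots,\nu_\ell)$ be an integer partition. Then there exist rational numbers $\xi_\delta$, indexed by integer partitions $\delta$ with $|\delta|\le|\nu|-1$, such that for every strict partition $\lambda$, $$D\Bigl(\frac{q_\nu(\lambda)}{H_\lambda}\Bigr)=\sum_{|\delta|\le|\nu|-1}\xi_\delta\,\frac{q_\delta(\lambda)}{H_\lambda}.$$
   Context: A strict partition is a finite strictly decreasing sequence of positive integers $\lambda=(\lambda_1>\cdots>\lambda_\ell)$ (the empty sequence is allowed); $\ell(\lambda)=\ell$, and $\lambda_i=0$ for $i>\ell(\lambda)$. The (shifted Young) diagram of $\lambda$ is the set of boxes $(i,j)$ with $1\le i\le\ell(\lambda)$, $i+1\le j\le i+\lambda_i$ (row $i$, column $j$); $\lambda$ is identified with its diagram. The hook length $h_\square$ of $\square=(i,j)\in\lambda$ is the number of boxes of $\lambda$ in row $i$ strictly to the right of $\square$, plus the number of boxes $(i',j)\in\lambda$ with $i'>i$, plus $1$, plus $\lambda_j$; $H_\lambda=\prod_{\square\in\lambda}h_\square$ ($H_\emptyset=1$). An outer corner of $\lambda$ is a box of $\lambda$ whose removal leaves the diagram of a strict partition. Let $(\alpha_1,\beta_1),\dots,(\alpha_m,\beta_m)$ be the outer corners with $\alpha_1>\cdots>\alpha_m$, and $y_j=\beta_j-\alpha_j$. Set $\alpha_{m+1}=0$, $\beta_0=\ell(\lambda)+1$, and $x_i=\beta_i-\alpha_{i+1}$ for $0\le i\le m$. For $k\ge0$, $q_k(\lambda)=\sum_{i=0}^m\binom{x_i}{2}^k-\sum_{i=1}^m\binom{y_i}{2}^k$,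 and for an integer partition $\nu=(\nu_1,\dots,\nu_\ell)$, $q_\nu(\lambda)=\prod_{j=1}^\ell q_{\nu_j}(\lambda)$ ($q_\emptyset=1$). $\lambda^+$ ranges over strict partitions obtained from $\lambda$ by adding one box; the difference operator is $DG(\lambda)=\sum_{\lambda^+:\ell(\lambda^+)>\ell(\lambda)}G(\lambda^+)+2\sum_{\lambda^+:\ell(\lambda^+)=\ell(\lambda)}G(\lambda^+)-G(\lambda)$. -}

module Defs where

open import Data.Nat.Base
  using (ℕ; zero; suc; _+_; _∸_; _^_; _<_; _>_; _≥_; NonZero; nonZero)
open import Data.Nat.Properties using (_≟_; _<?_; _>?_; _≥?_)
open import Data.Nat.Combinatorics using (_C_)
open import Data.Nat.ListAction using (sum; product)
open import Data.Nat.ListAction.Properties using (product≢0)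
open import Data.Integer.Base as ℤ using (ℤ)
open import Data.Rational.Base as ℚ using (ℚ; _/_; 0ℚ)
open import Data.List.Base
  using (List; []; _∷_; _++_; [_]; map; filter; length; upTo; reverse; zipWith;
         foldr; concatMap; mapMaybe)
open import Data.List.Relation.Unary.All using (All; all?; universal)
import Data.List.Relation.Unary.All.Properties as AllP
open import Data.List.Relation.Unary.Linked using (Linked; linked?)
open import Data.Maybe.Base as Maybe using (Maybe)
open import Data.Product.Base using (_×_; _,_; proj₁; proj₂)
open import Function.Base using (_∘_)
open import Relation.Nullary.Decidable using (Dec; _×-dec_; dec⇒maybe)

sumℚ : List ℚ → ℚ
sumℚ = foldr ℚ._+_ 0ℚ

productℤ : List ℤ → ℤ
productℤ = foldr ℤ._*_ (ℤ.+ 1)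

IsStrict : List ℕ → Set
IsStrict as = Linked _>_ as × All (0 <_) as

isStrict? : ∀ as → Dec (IsStrict as)
isStrict? as = linked? _>?_ as ×-dec all? (0 <?_) as

record StrictPartition : Set where
  constructor mkStrict
  field
    parts    : List ℕ
    isStrict : IsStrict parts

open StrictPartition public

strictPartition? : List ℕ → Maybe StrictPartition
strictPartition? as = Maybe.map (mkStrict as) (dec⇒maybe (isStrict? as))

IsPartition : List ℕ → Set
IsPartition as = Linked _≥_ as × All (0 <_) as

isPartition? : ∀ as → Dec (IsPartition as)
isPartition? as = linked? _≥?_ as ×-dec all? (0 <?_) as

record Partition : Set where
  constructor mkPartition
  field
    partsᵖ      : List ℕ
    isPartition : IsPartition partsᵖ

open Partition public

partition? : List ℕ → Maybe Partition
partition? as = Maybe.map (mkPartition as) (dec⇒maybe (isPartition? as))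

∣_∣ᵖ : Partition → ℕ
∣ ν ∣ᵖ = sum (partsᵖ ν)

-- Lists of at most l entries, each between 1 and b.
words : (l b : ℕ) → List (List ℕ)
words zero    b = [ [] ]
words (suc l) b = [] ∷ concatMap (λ k → map (suc k ∷_) (words l b)) (upTo b)

-- The integer partitions δ with |δ| < n.  Such a δ has fewer than n parts,
-- each smaller than n, so it occurs in  words n n.  Writing the bound
-- |δ| ≤ |ν| − 1 as |δ| < |ν| gives the empty index set when |ν| = 0.
partitionsBelow : ℕ → List Partition
partitionsBelow n = filter (λ δ → ∣ δ ∣ᵖ <? n) (mapMaybe partition? (words n n))

ℓ : StrictPartition → ℕ
ℓ lam = length (parts lam)

-- part as i is the i-th entry counted from 1, and 0 beyond the end of the list
-- (also at the unused index 0).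
part : List ℕ → ℕ → ℕ
part (a ∷ as) (suc zero)    = a
part (a ∷ as) (suc (suc i)) = part as (suc i)
part _        _             = 0

-- A box (row , column).
Box : Set
Box = ℕ × ℕ

-- The boxes (i , i+1), …, (i , i+a) of a row, followed by those of the later
-- rows, where i is the number of the first row of the list.
boxesFrom : ℕ → List ℕ → List Box
boxesFrom i []       = []
boxesFrom i (a ∷ as) = map (λ t → i , i + suc t) (upTo a) ++ boxesFrom (suc i) as

boxes : StrictPartition → List Box
boxes lam = boxesFrom 1 (parts lam)

arm : StrictPartition → Box → ℕ
arm lam (i , j) =
  length (filter (λ b → (proj₁ b ≟ i) ×-dec (proj₂ b >? j)) (boxes lam))

leg : StrictPartition → Box → ℕ
leg lam (i , j) =
  length (filter (λ b → (proj₁ b >? i) ×-dec (proj₂ b ≟ j)) (boxes lam))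

hook : StrictPartition → Box → ℕ
hook lam (i , j) = suc (arm lam (i , j) + leg lam (i , j) + part (parts lam) j)

H : StrictPartition → ℕ
H lam = product (map (hook lam) (boxes lam))

H≢0 : ∀ lam → NonZero (H lam)
H≢0 lam = product≢0 (AllP.map⁺ (universal (λ _ → nonZero) (boxes lam)))

infixl 7 _/H_

_/H_ : ℤ → StrictPartition → ℚ
z /H lam = (z / H lam) {{H≢0 lam}}

-- Each row number r, paired with its last box and with the rows left once that
-- box is deleted.  Deleting any other box of a row does not leave a diagram.
removalsFrom : ℕ → List ℕ → List (Box × List ℕ)
removalsFrom i []       = []
removalsFrom i (a ∷ as) =
  ((i , i + a) , shrink a as)
    ∷ map (λ r → proj₁ r , a ∷ proj₂ r) (removalsFrom (suc i) as)
  where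
  shrink : ℕ → List ℕ → List ℕ
  shrink (suc zero) as = as
  shrink a          as = (a ∸ 1) ∷ as

-- (α₁,β₁), …, (αₘ,βₘ), by decreasing row.
outerCorners : StrictPartition → List Box
outerCorners lam =
  reverse (map proj₁ (filter (isStrict? ∘ proj₂) (removalsFrom 1 (parts lam))))

-- x₀, …, xₘ.  Here and in ys the subtraction is never truncated, as
-- αᵢ₊₁ < αᵢ < βᵢ.
xs : StrictPartition → List ℕ
xs lam = zipWith _∸_ (suc (ℓ lam) ∷ map proj₂ (outerCorners lam))
                     (map proj₁ (outerCorners lam) ++ [ 0 ])

-- y₁, …, yₘ.
ys : StrictPartition → List ℕ
ys lam = map (λ b → proj₂ b ∸ proj₁ b) (outerCorners lam)

q : ℕ → StrictPartition → ℤ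
q k lam = ℤ.+ sum (map (λ x → (x C 2) ^ k) (xs lam))
    ℤ.- ℤ.+ sum (map (λ y → (y C 2) ^ k) (ys lam))

qᵖ : Partition → StrictPartition → ℤ
qᵖ ν lam = productℤ (map (λ k → q k lam) (partsᵖ ν))

-- The ways to lengthen one row by one box, or to start a new last row with one
-- box.
additions : List ℕ → List (List ℕ)
additions []       = [ [ 1 ] ]
additions (a ∷ as) = (suc a ∷ as) ∷ map (a ∷_) (additions as)

_⁺ : StrictPartition → List StrictPartition
lam ⁺ = mapMaybe strictPartition? (additions (parts lam))

D : (StrictPartition → ℚ) → StrictPartition → ℚ
D G lam =
  sumℚ (map G (filter (λ μ → ℓ μ >? ℓ lam) (lam ⁺)))
    ℚ.+ (ℤ.+ 2 / 1) ℚ.* sumℚ (map G (filter (λ μ → ℓ μ ≟ ℓ lam) (lam ⁺)))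
    ℚ.- G lam

-- The row-by-row enumerations above against the definitions through sets of
-- boxes; the main facts are partitionsBelow⇔, ⁺⇔ and outerCorners⇔, each with
-- the absence of repetitions (for corners, the ordering α₁ > ⋯ > αₘ).
module Adequacy where

  open import Data.Nat.Properties as ℕₚ
    hiding (_≟_; _<?_; _>?_; _≥?_)
  open import Data.Nat.Base using (_≤_; z≤n; s≤s; z<s; s≤s⁻¹)
  open import Data.List.Properties using (unfold-reverse)
  open import Data.List.Relation.Unary.All as All using ([]; _∷_)
  import Data.List.Relation.Unary.AllPairs.Properties as AllPairsP
  open import Data.List.Relation.Unary.AllPairs using (AllPairs; []; _∷_)
  open import Data.List.Relation.Unary.Any using (Any; here; there)
  open import Data.List.Relation.Unary.Any.Properties using (reverse⁺; reverse⁻)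
  open import Data.List.Relation.Unary.Linked as Linked using ([]; [-]; _∷_)
  open import Data.List.Relation.Unary.Unique.Propositional using (Unique)
  import Data.List.Relation.Unary.Unique.Propositional.Properties as Uniqueₚ
  open import Data.List.Membership.Propositional using (_∈_; _∉_)
  open import Data.List.Membership.Propositional.Properties
  open import Data.Maybe.Base using (just; nothing)
  open import Data.Product.Base as Prod using (∃; map₁; map₂)
  open import Data.Sum.Base using (_⊎_; inj₁; inj₂)
  open import Function.Bundles using (_⇔_; mk⇔; Equivalence)
  open import Relation.Nullary using (¬_; yes; no; contradiction)
  open import Relation.Binary.PropositionalEquality

  -- μ is λ with the one box b added.
  AddsBox : StrictPartition → Box → StrictPartition → Set
  AddsBox lam b μ =
    b ∉ boxes lam × (∀ c → c ∈ boxes μ ⇔ (c ∈ boxes lam ⊎ c ≡ b))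

  strict-irr : ∀ {as} (p q : IsStrict as) → p ≡ q
  strict-irr (p , p′) (q , q′) =
    cong₂ _,_ (Linked.irrelevant ℕₚ.<-irrelevant p q) (All.irrelevant ℕₚ.<-irrelevant p′ q′)

  part-irr : ∀ {as} (p q : IsPartition as) → p ≡ q
  part-irr (p , p′) (q , q′) =
    cong₂ _,_ (Linked.irrelevant ℕₚ.≤-irrelevant p q) (All.irrelevant ℕₚ.<-irrelevant p′ q′)

  module _ {A B : Set} (f : A → Maybe B) where

    ∈-mm⁺ : ∀ {x y} xs → x ∈ xs → f x ≡ just y → y ∈ mapMaybe f xs
    ∈-mm⁺ (x ∷ xs) (here refl) eq with f x
    ∈-mm⁺ (x ∷ xs) (here refl) refl | just y = here refl
    ∈-mm⁺ (x ∷ xs) (there p) eq with f x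
    ... | just _ = there (∈-mm⁺ xs p eq)
    ... | nothing = ∈-mm⁺ xs p eq

    ∈-mm⁻ : ∀ {y} xs → y ∈ mapMaybe f xs → ∃ λ x → x ∈ xs × f x ≡ just y
    ∈-mm⁻ (x ∷ xs) p with f x in eq
    ∈-mm⁻ (x ∷ xs) (here refl) | just y = x , here refl , eq
    ∈-mm⁻ (x ∷ xs) (there p) | just y = map₂ (map₁ there) (∈-mm⁻ xs p)
    ... | nothing = map₂ (map₁ there) (∈-mm⁻ xs p)

    mm-unique : (∀ {x x′ y} → f x ≡ just y → f x′ ≡ just y → x ≡ x′) →
      ∀ {xs} → Unique xs → Unique (mapMaybe f xs)
    mm-unique inj {[]} [] = []
    mm-unique inj {x ∷ xs} (x∉ ∷ u) with f x in eq
    ... | nothing = mm-unique inj u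
    ... | just y = All.tabulate (λ {z} z∈ y≡z → let x′ , x′∈ , eq′ = ∈-mm⁻ xs z∈ in
                     All.lookup x∉ x′∈ (inj eq (trans eq′ (cong just (sym y≡z))))) ∷ mm-unique inj u

  strict?-just : ∀ μ → strictPartition? (parts μ) ≡ just μ
  strict?-just (mkStrict as s) with isStrict? as
  ... | yes s′ = cong (just ∘ mkStrict as) (strict-irr s′ s)
  ... | no ¬s = contradiction s ¬s

  strict?-parts : ∀ {as μ} → strictPartition? as ≡ just μ → as ≡ parts μ
  strict?-parts {as} eq with isStrict? as
  strict?-parts refl | yes _ = refl

  part?-just : ∀ μ → partition? (partsᵖ μ) ≡ just μ
  part?-just (mkPartition as s) with isPartition? as
  ... | yes s′ = cong (just ∘ mkPartition as) (part-irr s′ s)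
  ... | no ¬s = contradiction s ¬s

  part?-parts : ∀ {as μ} → partition? as ≡ just μ → as ≡ partsᵖ μ
  part?-parts {as} eq with isPartition? as
  part?-parts refl | yes _ = refl

  words-complete : ∀ l b as → length as ≤ l → All (0 <_) as → All (_≤ b) as → as ∈ words l b
  words-complete zero b [] _ _ _ = here refl
  words-complete (suc l) b [] _ _ _ = here refl
  words-complete (suc l) b (suc a ∷ as) (s≤s le) (_ ∷ ps) (a≤ ∷ bs) =
    there (∈-concatMap⁺ _ (lem (∈-upTo⁺ a≤)))
    where
    lem : ∀ {ks} → a ∈ ks → Any ((suc a ∷ as ∈_) ∘ (λ k → map (suc k ∷_) (words l b))) ks
    lem (here refl) = here (∈-map⁺ (suc a ∷_) (words-complete l b as le ps bs))
    lem (there p) = there (lem p)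

  ∷-inj : ∀ {k : ℕ} {xs ys : List ℕ} → k ∷ xs ≡ k ∷ ys → xs ≡ ys
  ∷-inj refl = refl

  words-unique : ∀ l b → Unique (words l b)
  words-unique zero b = [] ∷ []
  words-unique (suc l) b =
    All.tabulate nope ∷ Uniqueₚ.concat⁺
       (AllP.map⁺ (All.universal (λ k → Uniqueₚ.map⁺ ∷-inj (words-unique l b)) (upTo b)))
       (disj (Uniqueₚ.upTo⁺ b))
    where
    g = λ k → map (suc k ∷_) (words l b)
    nope : ∀ {w} → w ∈ concatMap g (upTo b) → [] ≢ w
    nope w∈ refl = go (∈-concatMap⁻ g {xs = upTo b} w∈)
      where
      go : ∀ {ks} → ¬ Any (([] ∈_) ∘ g) ks
      go (here p) with _ , _ , () ← ∈-map⁻ _ p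
      go (there p) = go p
    disj1 : ∀ {k k′} → k ≢ k′ → ∀ {w} → ¬ (w ∈ g k × w ∈ g k′)
    disj1 k≢ (p , p′) with _ , _ , refl ← ∈-map⁻ _ p with _ , _ , refl ← ∈-map⁻ _ p′ = k≢ refl
    disj : ∀ {ks} → Unique ks → AllPairs (λ xs ys → ∀ {w} → ¬ (w ∈ xs × w ∈ ys)) (map g ks)
    disj [] = []
    disj (x ∷ u) = AllP.map⁺ (All.map (λ ne {w} → disj1 ne {w}) x) ∷ disj u

  length≤sum : ∀ {as} → All (0 <_) as → length as ≤ sum as
  length≤sum [] = z≤n
  length≤sum (p ∷ ps) = +-mono-≤ p (length≤sum ps)

  all≤sum : ∀ as → All (_≤ sum as) as
  all≤sum [] = []
  all≤sum (a ∷ as) = m≤m+n a _ ∷ All.map (λ p → ≤-trans p (m≤n+m _ a)) (all≤sum as)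

  partitionsBelow⇔ : ∀ {n δ} → δ ∈ partitionsBelow n ⇔ ∣ δ ∣ᵖ < n
  partitionsBelow⇔ {n} {δ} = mk⇔ (proj₂ ∘ ∈-filter⁻ (λ δ → ∣ δ ∣ᵖ ℕₚ.<? n) {xs = mapMaybe partition? (words n n)})
    (λ lt → ∈-filter⁺ (λ δ → ∣ δ ∣ᵖ ℕₚ.<? n)
       (∈-mm⁺ partition? (words n n)
         (words-complete n n (partsᵖ δ)
           (≤-trans (length≤sum (proj₂ (isPartition δ))) (<⇒≤ lt))
           (proj₂ (isPartition δ))
           (All.map (λ p → ≤-trans p (<⇒≤ lt)) (all≤sum (partsᵖ δ))))
         (part?-just δ)) lt)

  partitionsBelow-unique : ∀ n → Unique (partitionsBelow n)
  partitionsBelow-unique n = Uniqueₚ.filter⁺ _ (mm-unique partition?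
    (λ e e′ → trans (part?-parts e) (sym (part?-parts e′))) (words-unique n n))

  -- bs is as with its entry k ≥ 1 increased by one.
  Bump : List ℕ → ℕ → List ℕ → Set
  Bump as k bs = 0 < k × part bs k ≡ suc (part as k)
               × (∀ i → 0 < i → i ≢ k → part bs i ≡ part as i)

  part-[] : ∀ i → part [] i ≡ 0
  part-[] zero = refl
  part-[] (suc i) = refl

  ext : ∀ {as bs} → All (0 <_) as → All (0 <_) bs →
        (∀ i → 0 < i → part bs i ≡ part as i) → bs ≡ as
  ext [] [] e = refl
  ext [] (p ∷ _) e = contradiction (e 1 z<s) (>⇒≢ p)
  ext (p ∷ _) [] e = contradiction (sym (e 1 z<s)) (>⇒≢ p)
  ext (p ∷ ps) (r ∷ rs) e = cong₂ _∷_ (e 1 z<s) (ext ps rs λ { (suc i) _ → e (suc (suc i)) z<s })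

  bump-∷ : ∀ {as bs a k} → Bump as k bs → Bump (a ∷ as) (suc k) (a ∷ bs)
  bump-∷ {k = suc k} (_ , e , f) = z<s , e , λ where
    (suc zero) _ _ → refl
    (suc (suc i)) _ ne → f (suc i) z<s (ne ∘ cong suc)

  bump-here : ∀ {as a} → Bump (a ∷ as) 1 (suc a ∷ as)
  bump-here = z<s , refl , λ where
    (suc zero) _ ne → contradiction refl ne
    (suc (suc i)) _ _ → refl

  bump-[] : Bump [] 1 (1 ∷ [])
  bump-[] = z<s , refl , λ where
    (suc zero) _ ne → contradiction refl ne
    (suc (suc i)) _ _ → refl

  unbump : ∀ {as bs a b k} → Bump (a ∷ as) (2 + k) (b ∷ bs) → b ≡ a × Bump as (suc k) bs
  unbump (_ , e , f) = f 1 z<s (λ ()) , z<s , e , λ where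
    (suc i) _ ne → f (suc (suc i)) z<s (ne ∘ suc-injective)

  additions-sound : ∀ as {bs} → bs ∈ additions as → ∃ λ k → Bump as k bs
  additions-sound [] (here refl) = 1 , bump-[]
  additions-sound (a ∷ as) (here refl) = 1 , bump-here
  additions-sound (a ∷ as) (there p) with _ , p′ , refl ← ∈-map⁻ _ p =
    Prod.map suc bump-∷ (additions-sound as p′)

  additions-complete : ∀ {as bs k} → All (0 <_) as → All (0 <_) bs → Bump as k bs → bs ∈ additions as
  additions-complete {k = suc k} [] [] (_ , () , _)
  additions-complete {k = suc zero} [] (r ∷ rs) (_ , e , f) =
    here (cong₂ _∷_ e (ext [] rs λ { (suc i) _ → f (suc (suc i)) z<s (λ ()) }))
  additions-complete {k = suc (suc k)} [] (r ∷ rs) (_ , e , f) = contradiction (f 1 z<s (λ ())) (>⇒≢ r)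
  additions-complete {k = suc zero} (p ∷ ps) [] (_ , () , f)
  additions-complete {k = suc (suc k)} (p ∷ ps) [] (_ , e , f) = contradiction (sym (f 1 z<s (λ ()))) (>⇒≢ p)
  additions-complete {k = suc zero} (p ∷ ps) (r ∷ rs) (_ , e , f) =
    here (cong₂ _∷_ e (ext ps rs λ { (suc i) _ → f (suc (suc i)) z<s (λ ()) }))
  additions-complete {k = suc (suc k)} (p ∷ ps) (r ∷ rs) bmp with refl , bmp′ ← unbump bmp =
    there (∈-map⁺ _ (additions-complete ps rs bmp′))

  tail-strict : ∀ {a as} → IsStrict (a ∷ as) → IsStrict as
  tail-strict (l , _ ∷ ps) = Linked.tail l , ps

  removals-sound : ∀ s as {b bs} → IsStrict as → (b , bs) ∈ removalsFrom (suc s) as →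
    ∃ λ k → Bump bs k as × b ≡ (s + k , s + k + part as k)
  removals-sound s (zero ∷ as) (_ , () ∷ _) (here refl)
  removals-sound s (suc zero ∷ []) st (here refl) = 1 , bump-[] , cong (λ z → z , z + 1) (+-comm 1 s)
  removals-sound s (suc zero ∷ a ∷ as) ((s≤s a≤0 ∷ _) , _ ∷ 0<a ∷ _) (here refl) =
    contradiction (≤-trans 0<a a≤0) (λ ())
  removals-sound s (suc (suc a) ∷ as) st (here refl) =
    1 , bump-here , cong (λ z → z , z + (2 + a)) (+-comm 1 s)
  removals-sound s (a ∷ as) st (there p) with (b , bs) , p′ , refl ← ∈-map⁻ _ p
    with removals-sound (suc s) as (tail-strict st) p′
  ... | suc k , bmp , refl = suc (suc k) , bump-∷ bmp ,
         cong (λ z → z , z + part as (suc k)) (sym (+-suc s (suc k)))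

  removals-complete : ∀ s {as bs k} → All (0 <_) as → All (0 <_) bs → Bump bs k as →
    ((s + k , s + k + part as k) , bs) ∈ removalsFrom (suc s) as
  removals-complete s {k = suc k} [] ps (_ , () , _)
  removals-complete s {a ∷ as} {k = suc zero} (p ∷ ps) [] (_ , refl , f)
    with refl ← ext [] ps (λ { (suc i) _ → f (suc (suc i)) z<s (λ ()) }) =
    here (cong (λ z → (z , z + 1) , []) (+-comm s 1))
  removals-complete s {a ∷ as} {suc b ∷ bs} {k = suc zero} (p ∷ ps) (r ∷ rs) (_ , refl , f)
    with refl ← ext rs ps (λ { (suc i) _ → f (suc (suc i)) z<s (λ ()) }) =
    here (cong (λ z → (z , z + (2 + b)) , suc b ∷ bs) (+-comm s 1))
  removals-complete s {k = suc (suc k)} (p ∷ ps) [] (_ , e , f) = contradiction (f 1 z<s (λ ())) (>⇒≢ p)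
  removals-complete s {a ∷ as} {b ∷ bs} {k = suc (suc k)} (p ∷ ps) (r ∷ rs) bmp
    with refl , bmp′ ← unbump bmp = there
    (subst (λ z → ((z , z + part as (suc k)) , a ∷ bs) ∈ removalsTail)
       (sym (+-suc s (suc k))) (∈-map⁺ (λ r → proj₁ r , a ∷ proj₂ r) (removals-complete (suc s) ps rs bmp′)))
    where
    removalsTail : List (Box × List ℕ)
    removalsTail = map (λ r → proj₁ r , a ∷ proj₂ r) (removalsFrom (2 + s) as)

  InRow : List ℕ → ℕ → ℕ → ℕ → Set
  InRow as s k j = 0 < k × s + k < j × j ≤ s + k + part as k

  ∈-boxesFrom⁻ : ∀ s as {i j} → (i , j) ∈ boxesFrom (suc s) as → ∃ λ k → i ≡ s + k × InRow as s k j
  ∈-boxesFrom⁻ s (a ∷ as) {j = j} p with ∈-++⁻ (map (λ t → suc s , suc s + suc t) (upTo a)) p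
  ... | inj₁ p′ with t , t∈ , refl ← ∈-map⁻ _ p′ =
    1 , +-comm 1 s , z<s ,
    ≤-trans (≤-reflexive (cong suc (+-comm s 1))) (m<m+n (suc s) z<s) ,
    ≤-trans (+-monoʳ-≤ (suc s) (∈-upTo⁻ t∈)) (≤-reflexive (cong (_+ a) (+-comm 1 s)))
  ... | inj₂ p′ with suc k , refl , _ , lt , le ← ∈-boxesFrom⁻ (suc s) as p′ =
    suc (suc k) , sym (+-suc s (suc k)) , z<s ,
    subst (_< j) (sym (+-suc s (suc k))) lt ,
    subst (λ z → j ≤ z + part as (suc k)) (sym (+-suc s (suc k))) le

  ∈-boxesFrom⁺ : ∀ s as {k j} → InRow as s k j → (s + k , j) ∈ boxesFrom (suc s) as
  ∈-boxesFrom⁺ s [] {suc k} {j} (_ , lt , le) =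
    contradiction (<-≤-trans lt (≤-trans le (≤-reflexive (+-identityʳ _)))) (<-irrefl refl)
  ∈-boxesFrom⁺ s (a ∷ as) {suc zero} {j} (_ , lt , le) = ∈-++⁺ˡ
    (subst (_∈ map (λ t → suc s , suc s + suc t) (upTo a)) eq (∈-map⁺ _ (∈-upTo⁺ {i = t} t<)))
    where
    t = j ∸ suc (suc s)
    jeq : suc s + suc t ≡ j
    jeq = trans (+-suc (suc s) t) (m+[n∸m]≡n (subst (_< j) (+-comm s 1) lt))
    eq : (suc s , suc s + suc t) ≡ (s + 1 , j)
    eq = cong₂ _,_ (+-comm 1 s) jeq
    t< : t < a
    t< = +-cancelˡ-≤ (suc s) _ _ (≤-trans (≤-reflexive jeq) (subst (λ z → j ≤ z + a) (+-comm s 1) le))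
  ∈-boxesFrom⁺ s (a ∷ as) {suc (suc k)} {j} (_ , lt , le) = ∈-++⁺ʳ _
    (subst (λ z → (z , j) ∈ boxesFrom (2 + s) as) (sym (+-suc s (suc k)))
      (∈-boxesFrom⁺ (suc s) as (z<s , subst (_< j) (+-suc s (suc k)) lt ,
         subst (λ z → j ≤ z + part as (suc k)) (+-suc s (suc k)) le)))

  ∈-boxes⁻ : ∀ lam {i j} → (i , j) ∈ boxes lam → InRow (parts lam) 0 i j
  ∈-boxes⁻ lam p with _ , refl , r ← ∈-boxesFrom⁻ 0 (parts lam) p = r

  ∈-boxes⁺ : ∀ lam {i j} → InRow (parts lam) 0 i j → (i , j) ∈ boxes lam
  ∈-boxes⁺ lam = ∈-boxesFrom⁺ 0 (parts lam)

  bump⇒adds : ∀ lam μ {k} → Bump (parts lam) k (parts μ) → AddsBox lam (k , k + part (parts μ) k) μ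
  bump⇒adds lam μ {k} (k>0 , e , f) =
    (λ p → let _ , _ , le = ∈-boxes⁻ lam p in
       contradiction (≤-trans (≤-reflexive (cong (k +_) (sym e))) le) (<⇒≱ (+-monoʳ-< k (n<1+n _)))) ,
    λ (i , j) → mk⇔ (fwd i j) (bwd i j)
    where
    fwd : ∀ i j → (i , j) ∈ boxes μ → (i , j) ∈ boxes lam ⊎ (i , j) ≡ (k , k + part (parts μ) k)
    fwd i j p with i ℕₚ.≟ k | ∈-boxes⁻ μ p
    ... | no ne | i>0 , lt , le = inj₁ (∈-boxes⁺ lam (i>0 , lt , ≤-trans le (≤-reflexive (cong (i +_) (f i i>0 ne)))))
    ... | yes refl | i>0 , lt , le with j ℕₚ.≟ (k + part (parts μ) k)
    ...   | yes refl = inj₂ refl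
    ...   | no ne = inj₁ (∈-boxes⁺ lam (i>0 , lt ,
              s≤s⁻¹ (≤-trans (≤∧≢⇒< le ne) (≤-reflexive (trans (cong (k +_) e) (+-suc k _))))))
    bwd : ∀ i j → (i , j) ∈ boxes lam ⊎ (i , j) ≡ (k , k + part (parts μ) k) → (i , j) ∈ boxes μ
    bwd i j (inj₂ refl) = ∈-boxes⁺ μ (k>0 , m<m+n k (subst (0 <_) (sym e) z<s) , ≤-refl)
    bwd i j (inj₁ p) with i ℕₚ.≟ k | ∈-boxes⁻ lam p
    ... | no ne | i>0 , lt , le = ∈-boxes⁺ μ (i>0 , lt , ≤-trans le (≤-reflexive (cong (i +_) (sym (f i i>0 ne)))))
    ... | yes refl | i>0 , lt , le = ∈-boxes⁺ μ (i>0 , lt , ≤-trans le (+-monoʳ-≤ k (≤-trans (n≤1+n _) (≤-reflexive (sym e)))))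

  row≤ : ∀ lam μ i → 0 < i → (∀ j → (i , j) ∈ boxes lam → (i , j) ∈ boxes μ) →
         part (parts lam) i ≤ part (parts μ) i
  row≤ lam μ i i>0 h with part (parts lam) i in eq
  ... | zero = z≤n
  ... | suc a = +-cancelˡ-≤ i _ _ (proj₂ (proj₂ (∈-boxes⁻ μ (h (i + suc a)
          (∈-boxes⁺ lam (i>0 , m<m+n i z<s , ≤-reflexive (cong (i +_) (sym eq))))))))

  adds⇒bump : ∀ lam μ {k j} → AddsBox lam (k , j) μ →
              Bump (parts lam) k (parts μ) × j ≡ k + part (parts μ) k
  adds⇒bump lam μ {k} {j} (b∉ , h) = (k>0 , pk , off) , ≤-antisym j≤ ≤j
    where
    open Equivalence
    b∈ : InRow (parts μ) 0 k j
    b∈ = ∈-boxes⁻ μ (from (h (k , j)) (inj₂ refl))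
    k>0 = proj₁ b∈
    k<j = proj₁ (proj₂ b∈)
    j≤ = proj₂ (proj₂ b∈)
    j> : k + part (parts lam) k < j
    j> = ≰⇒> (λ le → b∉ (∈-boxes⁺ lam (k>0 , k<j , le)))
    only : ∀ j′ → k + part (parts lam) k < j′ → j′ ≤ k + part (parts μ) k → j′ ≡ j
    only j′ gt le with to (h (k , j′)) (∈-boxes⁺ μ (k>0 , ≤-<-trans (m≤m+n k _) gt , le))
    ... | inj₂ refl = refl
    ... | inj₁ p = contradiction (proj₂ (proj₂ (∈-boxes⁻ lam p))) (<⇒≱ gt)
    ≤j : k + part (parts μ) k ≤ j
    ≤j = ≤-reflexive (only _ (<-≤-trans j> j≤) ≤-refl)
    pk : part (parts μ) k ≡ suc (part (parts lam) k)
    pk = +-cancelˡ-≡ k _ _ (trans (≤-antisym ≤j j≤)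
          (trans (sym (only _ ≤-refl (≤-trans j> j≤))) (sym (+-suc k _))))
    off : ∀ i → 0 < i → i ≢ k → part (parts μ) i ≡ part (parts lam) i
    off i i>0 ne = ≤-antisym
      (row≤ μ lam i i>0 (λ j′ p → drop (to (h (i , j′)) p)))
      (row≤ lam μ i i>0 (λ j′ p → from (h (i , j′)) (inj₁ p)))
      where
      drop : ∀ {j′} → (i , j′) ∈ boxes lam ⊎ (i , j′) ≡ (k , j) → (i , j′) ∈ boxes lam
      drop (inj₁ p) = p
      drop (inj₂ refl) = contradiction refl ne

  ⁺⇔ : ∀ {lam μ} → μ ∈ lam ⁺ ⇔ (∃ λ b → AddsBox lam b μ)
  ⁺⇔ {lam} {μ} = mk⇔ fwd bwd
    where
    fwd : μ ∈ lam ⁺ → ∃ λ b → AddsBox lam b μ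
    fwd p with as , p′ , eq ← ∈-mm⁻ strictPartition? (additions (parts lam)) p
      with refl ← strict?-parts {as} eq = _ , bump⇒adds lam μ (proj₂ (additions-sound (parts lam) p′))
    bwd : (∃ λ b → AddsBox lam b μ) → μ ∈ lam ⁺
    bwd (b , ab) = ∈-mm⁺ strictPartition? (additions (parts lam))
      (additions-complete (proj₂ (isStrict lam)) (proj₂ (isStrict μ)) (proj₁ (adds⇒bump lam μ ab)))
      (strict?-just μ)

  additions-unique : ∀ as → Unique (additions as)
  additions-unique [] = [] ∷ []
  additions-unique (a ∷ as) =
    AllP.map⁺ (All.universal (λ _ e → 1+n≢n (cong hd e)) (additions as)) ∷ Uniqueₚ.map⁺ ∷-inj (additions-unique as)
    where
    hd : List ℕ → ℕ
    hd [] = 0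
    hd (x ∷ _) = x

  ⁺-unique : ∀ lam → Unique (lam ⁺)
  ⁺-unique lam = mm-unique strictPartition?
    (λ e e′ → trans (strict?-parts e) (sym (strict?-parts e′))) (additions-unique (parts lam))

  outerCorners⇔ : ∀ {lam b} → b ∈ outerCorners lam ⇔ (∃ λ μ → AddsBox μ b lam)
  outerCorners⇔ {lam} {b} = mk⇔ fwd bwd
    where
    P? = isStrict? ∘ proj₂ {A = Box} {B = λ _ → List ℕ}
    fwd : b ∈ outerCorners lam → ∃ λ μ → AddsBox μ b lam
    fwd p with (_ , bs) , p′ , refl ← ∈-map⁻ proj₁ {xs = filter P? (removalsFrom 1 (parts lam))} (reverse⁻ p)
      with p″ , st ← ∈-filter⁻ P? {xs = removalsFrom 1 (parts lam)} p′
      with k , bmp , refl ← removals-sound 0 (parts lam) (isStrict lam) p″ =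
      mkStrict bs st , bump⇒adds (mkStrict bs st) lam bmp
    bwd : (∃ λ μ → AddsBox μ b lam) → b ∈ outerCorners lam
    bwd (μ , ab) with bmp , refl ← adds⇒bump μ lam ab =
      reverse⁺ (∈-map⁺ proj₁ (∈-filter⁺ P?
        (removals-complete 0 (proj₂ (isStrict lam)) (proj₂ (isStrict μ)) bmp) (isStrict μ)))

  removals-rows : ∀ i as → AllPairs (λ r r′ → proj₁ (proj₁ r) < proj₁ (proj₁ r′)) (removalsFrom i as)
  removals-rows i [] = []
  removals-rows i (a ∷ as) =
    AllP.map⁺ (later (suc i) as) ∷ AllPairsP.map⁺ (removals-rows (suc i) as)
    where
    later : ∀ k as → All (λ r → k ≤ proj₁ (proj₁ r)) (removalsFrom k as)
    later k [] = []
    later k (a ∷ as) = ≤-refl ∷ AllP.map⁺ (All.map <⇒≤ (later (suc k) as))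

  reverse-AllPairs : ∀ {A : Set} {R : A → A → Set} {xs} →
    AllPairs R xs → AllPairs (λ x y → R y x) (reverse xs)
  reverse-AllPairs [] = []
  reverse-AllPairs {R = R} {x ∷ xs} (p ∷ ps) =
    subst (AllPairs (λ x y → R y x)) (sym (unfold-reverse x xs))
      (AllPairsP.++⁺ (reverse-AllPairs ps) ([] ∷ [])
        (All.tabulate (λ y∈ → All.lookup p (reverse⁻ y∈) ∷ [])))

  outerCorners-descending : ∀ lam →
    AllPairs (λ b b′ → proj₁ b > proj₁ b′) (outerCorners lam)
  outerCorners-descending lam = reverse-AllPairs (AllPairsP.map⁺
    (AllPairsP.filter⁺ (isStrict? ∘ proj₂) (removals-rows 1 (parts lam))))

{-# OPTIONS --safe #-}
module Submission where

{- Put t_a = C(a, 2) and z_b = C(b + 1, 2).  Telescoping along runs of consecutive parts gives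
q_k(λ) = Σ_{a ∈ λ} (z_a^k - t_a^k) for k ≥ 1, so enlarging a part b (b = 0 for a new row) changes
q_k by a polynomial of degree less than k in z_b.  By the hook length formula the weights with
which D sums over the enlarged partitions, relative to 1 / H_λ, are the coefficients of
1 / (X - z_b) in the partial fraction expansion of Π_a (X - t_a) / (X Π_a (X - z_a)).  The r-th
moment of these weights is therefore the r-th complete homogeneous function of the z's minus the
t's, which by Newton's identity is a polynomial of weight r in q_1, q_2, ….  Expanding
Π_j (q_{ν_j} + Δ q_{ν_j}) - Π_j q_{ν_j} and summing, every term loses at least one unit of weight. -}

open import Defs
open import Data.Rational.Base using (ℚ; _*_)
open import Data.List.Base using (map)
open import Data.Product.Base using (Σ-syntax)
open import Relation.Binary.PropositionalEquality using (_≡_)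

open import Data.Rational.Base
  using (0ℚ; 1ℚ; _+_; _-_; -_; _/_; 1/_; toℚᵘ; ≢-nonZero)
open import Data.Rational.Properties as ℚₚ
  using (+-*-commutativeRing; *-identityˡ; *-identityʳ; *-zeroˡ; *-zeroʳ; *-assoc;
         *-distribˡ-+; *-distribʳ-+; *-inverseʳ; +-identityˡ; +-identityʳ; +-assoc; +-inverseʳ;
         toℚᵘ-injective; toℚᵘ-cong; toℚᵘ-fromℚᵘ; toℚᵘ-homo-+; toℚᵘ-homo-*)
import Data.Rational.Unnormalised.Base as ℚᵘ
import Data.Rational.Unnormalised.Properties as ℚᵘₚ
open import Data.Nat.Base as ℕ using (ℕ; zero; suc; _∸_; _!)
import Data.Nat.Properties as ℕₚ
open import Data.Nat.Combinatorics as Comb using (_C_)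
open import Data.Nat.ListAction using (sum; product)
open import Data.Nat.ListAction.Properties using (sum-++; sum-↭; product-++)
import Data.Nat.Tactic.RingSolver as ℕ-RingSolver
import Data.Integer.Base as ℤ
import Data.Integer.Properties as ℤₚ
open import Data.Bool.Base using (if_then_else_)
open import Data.List.Base
  using (List; _∷_; []; _++_; filter; length; mapMaybe; reverse; zipWith; applyUpTo; upTo)
open import Data.List.Properties
  using (filter-all; filter-none; filter-accept; filter-reject; filter-++; length-applyUpTo;
         length-++; length-map; map-upTo; map-++; map-∘; map-cong; ++-assoc; unfold-reverse; ≡-dec)
import Data.List.Sort
open import Data.List.Membership.Propositional using (_∈_)
open import Data.List.Relation.Binary.Permutation.Propositional as Perm using (_↭_; ↭-sym)
open import Data.List.Relation.Binary.Permutation.Propositional.Properties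
  using (map⁺; ↭-reverse; All-resp-↭)
open import Data.List.Relation.Unary.All as All using (All; []; _∷_)
import Data.List.Relation.Unary.All.Properties as Allₚ
open import Data.List.Relation.Unary.AllPairs using ([]; _∷_)
open import Data.List.Relation.Unary.Any using (here; there)
open import Data.List.Relation.Unary.Linked as Linked using ([]; [-]; _∷_)
import Data.List.Relation.Unary.Linked.Properties as Linkedₚ
open import Data.List.Relation.Unary.Unique.Propositional using (Unique)
open import Data.Product.Base using (_×_; _,_; proj₁; proj₂; ∃)
open import Data.Sum.Base using (_⊎_; inj₁; inj₂; [_,_]′)
open import Data.Unit.Base using (⊤; tt)
open import Algebra.Bundles using (CommutativeRing)
open import Algebra.Properties.Semiring.Exp (CommutativeRing.semiring +-*-commutativeRing)
  using (_^_; ^-homo-*)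
open import Function.Base using (_∘_)
open import Function.Bundles using (_⇔_; mk⇔; Equivalence)
open import Level using (0ℓ)
import Relation.Binary.Construct.Flip.EqAndOrd as Flip
open import Relation.Binary.PropositionalEquality
  using (_≢_; refl; sym; trans; cong; cong₂; subst; module ≡-Reasoning)
open import Relation.Nullary using (¬_; Dec; does; yes; no; contradiction)
open import Relation.Nullary.Decidable using (dec⇒maybe; dec-true; dec-false; _×-dec_)
open import Relation.Unary using (Decidable)
open import Tactic.RingSolver using (solve-∀)
open import Tactic.RingSolver.Core.AlmostCommutativeRing
  using (AlmostCommutativeRing; fromCommutativeRing)

-- The numbers ξ have to be chosen before λ is known. `Poly` therefore certifies, uniformly in the
-- partition, that a function is a polynomial of bounded weight, and `expand` reads the coefficients
-- off the certificate alone. The weights of the partial fraction expansion are never written out.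
-- Multiplying R(X) = Σ w_b / (X - z_b) by (X - t_a) / (X - z_a) multiplies the residue at each old
-- pole z_b by (z_b - t_a) / (z_b - z_a) and creates the residue (z_a - t_a) R(z_a) at z_a. Paired
-- with a function f, both effects together are the single divided difference `dd a f`. So `E` is a
-- recursion along the parts, just as the product of the hook lengths is. D sums over strict
-- partitions only, whereas the recursion enlarges every row in turn. The two sums agree because the
-- inverse hook product, continued by its closed form to lists with a repeated part, vanishes there.
-- Indices of power sums stay positive throughout, since q_0 = 1 while the telescoped sum gives 0
-- for k = 0.

-- Rational arithmetic and the embedding of the integers

ring : AlmostCommutativeRing 0ℓ 0ℓ
ring = fromCommutativeRing +-*-commutativeRing λ x → dec⇒maybe (0ℚ ℚₚ.≟ x)

2ℚ : ℚ
2ℚ = 1ℚ + 1ℚ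

opaque
  -- Total, with value 0 at 0, so that divided differences and hook quotients can be written down at
  -- every argument; a nonzero argument is demanded only where a quotient is cancelled.
  inv : ℚ → ℚ
  inv p with p ℚₚ.≟ 0ℚ
  ... | yes _ = 0ℚ
  ... | no p≢0 = 1/_ p {{≢-nonZero p≢0}}

  *-inv : ∀ {p} → p ≢ 0ℚ → p * inv p ≡ 1ℚ
  *-inv {p} p≢0 with p ℚₚ.≟ 0ℚ
  ... | yes p≡0 = contradiction p≡0 p≢0
  ... | no p≢0′ = *-inverseʳ p {{≢-nonZero p≢0′}}

cancelˡ : ∀ k {x y} → k ≢ 0ℚ → k * x ≡ k * y → x ≡ y
cancelˡ k {x} {y} k≢0 eq = trans (expand x) (trans (cong (inv k *_) eq) (sym (expand y)))
  where
  assoc : ∀ i k x → (k * i) * x ≡ i * (k * x)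
  assoc = solve-∀ ring
  expand : ∀ x → x ≡ inv k * (k * x)
  expand x = trans (sym (*-identityˡ x)) (trans (cong (_* x) (sym (*-inv k≢0))) (assoc (inv k) k x))

ι : ℤ.ℤ → ℚ
ι z = z / 1

ι-toℚᵘ : ∀ z → toℚᵘ (ι z) ℚᵘ.≃ ℚᵘ.mkℚᵘ z 0
ι-toℚᵘ z = toℚᵘ-fromℚᵘ (ℚᵘ.mkℚᵘ z 0)

ι-+ : ∀ x y → ι (x ℤ.+ y) ≡ ι x + ι y
ι-+ x y = toℚᵘ-injective (ℚᵘₚ.≃-trans (ι-toℚᵘ (x ℤ.+ y)) (ℚᵘₚ.≃-sym
  (ℚᵘₚ.≃-trans (toℚᵘ-homo-+ (ι x) (ι y)) (ℚᵘₚ.≃-trans (ℚᵘₚ.+-cong (ι-toℚᵘ x) (ι-toℚᵘ y))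
    (ℚᵘ.*≡* (cong (ℤ._* (ℤ.+ 1)) (cong₂ ℤ._+_ (ℤₚ.*-identityʳ x) (ℤₚ.*-identityʳ y))))))))

ι-* : ∀ x y → ι (x ℤ.* y) ≡ ι x * ι y
ι-* x y = toℚᵘ-injective (ℚᵘₚ.≃-trans (ι-toℚᵘ (x ℤ.* y)) (ℚᵘₚ.≃-sym
  (ℚᵘₚ.≃-trans (toℚᵘ-homo-* (ι x) (ι y)) (ℚᵘₚ.≃-trans (ℚᵘₚ.*-cong (ι-toℚᵘ x) (ι-toℚᵘ y)) ℚᵘₚ.≃-refl))))

ι-neg : ∀ x → ι (ℤ.- x) ≡ - ι x
ι-neg x = trans (lem (ι x) (ι (ℤ.- x))) (trans (cong (λ s → s - ι x)
            (trans (sym (ι-+ x (ℤ.- x))) (cong ι (ℤₚ.+-inverseʳ x)))) (+-identityˡ _))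
  where
  lem : ∀ x y → y ≡ (x + y) - x
  lem = solve-∀ ring

ι-injective : ∀ {x y} → ι x ≡ ι y → x ≡ y
ι-injective {x} {y} eq with ℚᵘₚ.≃-trans (ℚᵘₚ.≃-sym (ι-toℚᵘ x)) (ℚᵘₚ.≃-trans (toℚᵘ-cong eq) (ι-toℚᵘ y))
... | ℚᵘ.*≡* e = trans (sym (ℤₚ.*-identityʳ x)) (trans e (ℤₚ.*-identityʳ y))

opaque
  fromℕ : ℕ → ℚ
  fromℕ n = ι (ℤ.+ n)

  fromℕ-+ : ∀ m n → fromℕ (m ℕ.+ n) ≡ fromℕ m + fromℕ n
  fromℕ-+ m n = ι-+ (ℤ.+ m) (ℤ.+ n)

  fromℕ-* : ∀ m n → fromℕ (m ℕ.* n) ≡ fromℕ m * fromℕ n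
  fromℕ-* m n = trans (cong ι (ℤₚ.pos-* m n)) (ι-* (ℤ.+ m) (ℤ.+ n))

  fromℕ-suc : ∀ n → fromℕ (suc n) ≡ 1ℚ + fromℕ n
  fromℕ-suc n = ι-+ (ℤ.+ 1) (ℤ.+ n)

  fromℕ-^ : ∀ m k → fromℕ (m ℕ.^ k) ≡ fromℕ m ^ k
  fromℕ-^ m zero = refl
  fromℕ-^ m (suc k) = trans (fromℕ-* m (m ℕ.^ k)) (cong (fromℕ m *_) (fromℕ-^ m k))

  fromℕ-injective : ∀ {m n} → fromℕ m ≡ fromℕ n → m ≡ n
  fromℕ-injective = ℤₚ.+-injective ∘ ι-injective

  /-fromℕ : ∀ i n .{{_ : ℕ.NonZero n}} → (i / n) * fromℕ n ≡ ι i
  /-fromℕ i (suc n) = toℚᵘ-injective (ℚᵘₚ.≃-trans (toℚᵘ-homo-* (i / suc n) (fromℕ (suc n)))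
    (ℚᵘₚ.≃-trans (ℚᵘₚ.*-cong (toℚᵘ-fromℚᵘ (ℚᵘ.mkℚᵘ i n)) (ι-toℚᵘ (ℤ.+ suc n)))
      (ℚᵘₚ.≃-trans (ℚᵘ.*≡* (ℤₚ.*-assoc i (ℤ.+ suc n) (ℤ.+ 1))) (ℚᵘₚ.≃-sym (ι-toℚᵘ i)))))

  ι≡fromℕ : ∀ n → ι (ℤ.+ n) ≡ fromℕ n
  ι≡fromℕ n = refl

  fromℕ-0 : fromℕ 0 ≡ 0ℚ
  fromℕ-0 = refl

  fromℕ-1 : fromℕ 1 ≡ 1ℚ
  fromℕ-1 = refl

fromℕ-suc≢0 : ∀ n → fromℕ (suc n) ≢ 0ℚ
fromℕ-suc≢0 n eq = contradiction (fromℕ-injective {suc n} {0} (trans eq (sym fromℕ-0))) λ ()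

-- The triangular numbers t and z

opaque
  t : ℕ → ℚ
  t a = fromℕ (a C 2)

  t≡ : ∀ a → t a ≡ fromℕ (a C 2)
  t≡ a = refl

z : ℕ → ℚ
z b = t (suc b)

C2-suc : ∀ a → suc a C 2 ≡ a ℕ.+ a C 2
C2-suc a = trans (sym (Comb.nCk+nC[k+1]≡[n+1]C[k+1] a 1)) (cong (ℕ._+ a C 2) (Comb.nC1≡n a))

z-t : ∀ a → z a ≡ fromℕ a + t a
z-t a = trans (t≡ (suc a)) (trans (cong fromℕ (C2-suc a))
  (trans (fromℕ-+ a (a C 2)) (cong (fromℕ a +_) (sym (t≡ a)))))

2*t : ∀ a → 2ℚ * t a ≡ fromℕ a * (fromℕ a - 1ℚ)
2*t zero = trans (cong (2ℚ *_) (trans (t≡ 0) fromℕ-0)) (sym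
  (trans (cong (λ x → x * (x - 1ℚ)) fromℕ-0) refl))
2*t (suc a) = begin
  2ℚ * t (suc a)                        ≡⟨ cong (2ℚ *_) (z-t a) ⟩
  2ℚ * (fromℕ a + t a)                  ≡⟨ *-distribˡ-+ 2ℚ (fromℕ a) (t a) ⟩
  2ℚ * fromℕ a + 2ℚ * t a               ≡⟨ cong (2ℚ * fromℕ a +_) (2*t a) ⟩
  2ℚ * fromℕ a + fromℕ a * (fromℕ a - 1ℚ) ≡⟨ lem (fromℕ a) ⟩
  (1ℚ + fromℕ a) * ((1ℚ + fromℕ a) - 1ℚ)  ≡⟨ cong (λ x → x * (x - 1ℚ)) (fromℕ-suc a) ⟨
  fromℕ (suc a) * (fromℕ (suc a) - 1ℚ)  ∎
  where
  open ≡-Reasoning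
  lem : ∀ x → (1ℚ + 1ℚ) * x + x * (x - 1ℚ) ≡ (1ℚ + x) * ((1ℚ + x) - 1ℚ)
  lem = solve-∀ ring

z-0 : z 0 ≡ 0ℚ
z-0 = trans (t≡ 1) fromℕ-0

C2-mono-< : ∀ {a b} → 0 ℕ.< a → a ℕ.< b → a C 2 ℕ.< b C 2
C2-mono-< {a} {suc b} 0<a a<1+b with ℕₚ.m≤n⇒m<n∨m≡n (ℕₚ.≤-pred a<1+b)
... | inj₁ a<b = ℕₚ.<-≤-trans (C2-mono-< 0<a a<b) (subst (b C 2 ℕ.≤_) (sym (C2-suc b)) (ℕₚ.m≤n+m _ b))
... | inj₂ refl = subst (a C 2 ℕ.<_) (sym (C2-suc a)) (ℕₚ.m<n+m _ 0<a)

z-≢ : ∀ {a b} → b ℕ.< a → z b - z a ≢ 0ℚ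
z-≢ {a} {b} b<a eq =
  contradiction (fromℕ-injective {suc b C 2} {suc a C 2} (trans (sym (t≡ (suc b)))
    (trans (trans (lem (z b) (z a)) (trans (cong (_+ z a) eq) (+-identityˡ _))) (t≡ (suc a)))))
  (ℕₚ.<⇒≢ (C2-mono-< (ℕ.s≤s ℕ.z≤n) (ℕ.s≤s b<a)))
  where
  lem : ∀ x y → x ≡ (x - y) + y
  lem = solve-∀ ring

-- The weights of D as iterated divided differences, and their moments

data Decreasing : List ℕ → Set where
  []   : Decreasing []
  cons : ∀ {a as} → 0 ℕ.< a → All (ℕ._< a) as → Decreasing as → Decreasing (a ∷ as)

-- The divided difference of (x - t a) f(x) at x = z b and x = z a, f being regarded as a function of z.
dd : ℕ → (ℕ → ℚ) → ℕ → ℚ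
dd a f b = ((z b - t a) * f b - (z a - t a) * f a) * inv (z b - z a)

-- E as f = Σ w_b f(b) over b ∈ 0 ∷ as, where w_b is the coefficient of 1 / (X - z b) in
-- Π_a (X - t a) / (X Π_a (X - z a)).
E : List ℕ → (ℕ → ℚ) → ℚ
E []       f = f 0
E (a ∷ as) f = E as (dd a f)

-- Only the values at 0 and at the parts enter. The restriction matters because the denominator z b
-- - z a of `dd a` can be cancelled only where it is nonzero; `E-below` specialises P to b < a,
-- where it is.
E-cong : (P : ℕ → Set) → P 0 → ∀ {as} → All P as → ∀ {f g} → (∀ b → P b → f b ≡ g b) → E as f ≡ E as g
E-cong P p0 []        h = h 0 p0
E-cong P p0 {a ∷ _} (pa ∷ ps) h = E-cong P p0 ps λ b pb →
  cong₂ (λ x y → ((z b - t a) * x - (z a - t a) * y) * inv (z b - z a)) (h b pb) (h a pa)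

E-ext : ∀ as {f g} → (∀ b → f b ≡ g b) → E as f ≡ E as g
E-ext as h = E-cong (λ _ → ⊤) tt (All.universal (λ _ → tt) as) (λ b _ → h b)

E-below : ∀ {a as} → 0 ℕ.< a → All (ℕ._< a) as → ∀ {f g} → (∀ b → b ℕ.< a → f b ≡ g b) → E as f ≡ E as g
E-below 0<a as<a h = E-cong (ℕ._< _) 0<a as<a h

E-linear : ∀ as k l f g → E as (λ b → k * f b + l * g b) ≡ k * E as f + l * E as g
E-linear []       k l f g = refl
E-linear (a ∷ as) k l f g =
  trans (E-ext as (λ b → lem k l (z b - t a) (z a - t a) (f b) (g b) (f a) (g a) (inv (z b - z a))))
        (E-linear as k l (dd a f) (dd a g))
  where
  lem : ∀ k l x y fb gb fa ga d → (x * (k * fb + l * gb) - y * (k * fa + l * ga)) * d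
        ≡ k * ((x * fb - y * fa) * d) + l * ((x * gb - y * ga) * d)
  lem = solve-∀ ring

E-scale : ∀ as k f → E as (λ b → k * f b) ≡ k * E as f
E-scale as k f =
  trans (E-ext as (λ b → l1 (k * f b) (f b))) (trans (E-linear as k 0ℚ f f) (l2 (k * E as f) (E as f)))
  where
  l1 : ∀ x y → x ≡ x + 0ℚ * y
  l1 = solve-∀ ring
  l2 : ∀ x y → x + 0ℚ * y ≡ x
  l2 = solve-∀ ring

E-+ : ∀ as f g → E as (λ b → f b + g b) ≡ E as f + E as g
E-+ as f g = trans (E-ext as (λ b → sym (cong₂ _+_ (*-identityˡ (f b)) (*-identityˡ (g b)))))
  (trans (E-linear as 1ℚ 1ℚ f g) (cong₂ _+_ (*-identityˡ (E as f)) (*-identityˡ (E as g))))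

E-0 : ∀ as → E as (λ _ → 0ℚ) ≡ 0ℚ
E-0 as = trans (E-scale as 0ℚ (λ _ → 0ℚ)) (*-zeroˡ (E as (λ _ → 0ℚ)))

moment : List ℕ → ℕ → ℚ
moment as r = E as (λ b → z b ^ r)

moment-0 : ∀ {as} → Decreasing as → moment as 0 ≡ 1ℚ
moment-0 [] = refl
moment-0 {a ∷ as} (cons 0<a as<a dec) = trans (E-below 0<a as<a step) (moment-0 dec)
  where
  lem : ∀ zb ta za d → ((zb - ta) * 1ℚ - (za - ta) * 1ℚ) * d ≡ (zb - za) * d
  lem = solve-∀ ring
  step : ∀ b → b ℕ.< a → dd a (λ _ → 1ℚ) b ≡ 1ℚ
  step b b<a = trans (lem (z b) (t a) (z a) (inv (z b - z a))) (*-inv (z-≢ b<a))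

-- For the generating functions S and S′ of the moments of `a ∷ as` and `as` this says (1 - z a T) S
-- = (1 - t a T) S′. The function (z b - z a) z b ^ r vanishes at b = a, so in its divided
-- difference only the term at b survives and the denominator cancels.
moment-cons : ∀ {a as} → Decreasing (a ∷ as) → ∀ r →
  moment (a ∷ as) (suc r) ≡ z a * moment (a ∷ as) r + (moment as (suc r) - t a * moment as r)
moment-cons {a} {as} (cons 0<a as<a _) r =
  trans (lem (moment (a ∷ as) (suc r)) (moment (a ∷ as) r) (z a))
    (cong (z a * moment (a ∷ as) r +_) (begin
    1ℚ * moment (a ∷ as) (suc r) + (- z a) * moment (a ∷ as) r ≡⟨ E-linear as 1ℚ (- z a) _ _ ⟨
    E as (λ b → 1ℚ * dd a (λ b → z b ^ suc r) b + (- z a) * dd a (λ b → z b ^ r) b)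
      ≡⟨ E-below 0<a as<a step ⟩
    E as (λ b → 1ℚ * z b ^ suc r + (- t a) * z b ^ r)         ≡⟨ E-linear as 1ℚ (- t a) _ _ ⟩
    1ℚ * moment as (suc r) + (- t a) * moment as r
      ≡⟨ lem₂ (moment as (suc r)) (moment as r) (t a) ⟩
    moment as (suc r) - t a * moment as r                      ∎))
  where
  open ≡-Reasoning
  lem : ∀ m n x → m ≡ x * n + (1ℚ * m + (- x) * n)
  lem = solve-∀ ring
  lem₂ : ∀ m n x → 1ℚ * m + (- x) * n ≡ m - x * n
  lem₂ = solve-∀ ring
  lem₃ : ∀ zb za ta w v d →
    1ℚ * (((zb - ta) * (zb * w) - (za - ta) * (za * v)) * d) + (- za) * (((zb - ta) * w -
      (za - ta) * v) * d)
      ≡ (zb - ta) * w * ((zb - za) * d)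
  lem₃ = solve-∀ ring
  lem₄ : ∀ zb ta w → (zb - ta) * w * 1ℚ ≡ 1ℚ * (zb * w) + (- ta) * w
  lem₄ = solve-∀ ring
  step : ∀ b → b ℕ.< a → 1ℚ * dd a (λ b → z b ^ suc r) b + (- z a) * dd a (λ b → z b ^ r) b
    ≡ 1ℚ * z b ^ suc r + (- t a) * z b ^ r
  step b b<a = trans (lem₃ (z b) (z a) (t a) (z b ^ r) (z a ^ r) (inv (z b - z a)))
    (trans (cong ((z b - t a) * z b ^ r *_) (*-inv (z-≢ b<a))) (lem₄ (z b) (t a) (z b ^ r)))

-- Newton’s identity

conv : (ℕ → ℚ) → (ℕ → ℚ) → ℕ → ℚ
conv f g zero    = f 0 * g 0
conv f g (suc r) = f 0 * g (suc r) + conv (f ∘ suc) g r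

conv-cong : ∀ {f f′} g r → (∀ k → f k ≡ f′ k) → conv f g r ≡ conv f′ g r
conv-cong g zero    h = cong (_* g 0) (h 0)
conv-cong g (suc r) h = cong₂ (λ x y → x * g (suc r) + y) (h 0) (conv-cong g r (h ∘ suc))

conv-add : ∀ f f′ g r → conv (λ k → f k + f′ k) g r ≡ conv f g r + conv f′ g r
conv-add f f′ g zero    = *-distribʳ-+ (g 0) (f 0) (f′ 0)
conv-add f f′ g (suc r) = trans (cong ((f 0 + f′ 0) * g (suc r) +_) (conv-add (f ∘ suc) (f′ ∘ suc) g r))
  (lem (f 0) (f′ 0) (g (suc r)) (conv (f ∘ suc) g r) (conv (f′ ∘ suc) g r))
  where
  lem : ∀ x y g m n → (x + y) * g + (m + n) ≡ (x * g + m) + (y * g + n)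
  lem = solve-∀ ring

conv-scale : ∀ x f g r → conv (λ k → x * f k) g r ≡ x * conv f g r
conv-scale x f g zero    = *-assoc x (f 0) (g 0)
conv-scale x f g (suc r) = trans (cong (x * f 0 * g (suc r) +_) (conv-scale x (f ∘ suc) g r))
  (lem x (f 0) (g (suc r)) (conv (f ∘ suc) g r))
  where
  lem : ∀ x f g c → x * f * g + x * c ≡ x * (f * g + c)
  lem = solve-∀ ring

conv-0 : ∀ g r → conv (λ _ → 0ℚ) g r ≡ 0ℚ
conv-0 g r = trans (conv-scale 0ℚ (λ _ → 0ℚ) g r) (*-zeroˡ (conv (λ _ → 0ℚ) g r))

-- (1 - x T) G = (1 - y T) G′ for the generating functions of g and g′ implies the same for F G and F G′.
conv-shift : ∀ x y f g g′ → g 0 ≡ g′ 0 → (∀ r → g (suc r) - x * g r ≡ g′ (suc r) - y * g′ r) →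
  ∀ r → conv f g (suc r) - x * conv f g r ≡ conv f g′ (suc r) - y * conv f g′ r
conv-shift x y f g g′ e h zero =
  trans (lem (f 0) (g 1) x (g 0) (f 1)) (trans (cong₂ (λ d g₀ → f 0 * d + f 1 * g₀) (h 0) e)
    (sym (lem (f 0) (g′ 1) y (g′ 0) (f 1))))
  where
  lem : ∀ f g₁ x g₀ f₁ → (f * g₁ + f₁ * g₀) - x * (f * g₀) ≡ f * (g₁ - x * g₀) + f₁ * g₀
  lem = solve-∀ ring
conv-shift x y f g g′ e h (suc r) =
  trans (lem (f 0) (g (suc (suc r))) x (g (suc r)) (conv (f ∘ suc) g (suc r)) (conv (f ∘ suc) g r))
    (trans (cong₂ (λ d c → f 0 * d + c) (h (suc r)) (conv-shift x y (f ∘ suc) g g′ e h r))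
      (sym (lem (f 0) (g′ (suc (suc r))) y (g′ (suc r)) (conv (f ∘ suc) g′ (suc r)) (conv
        (f ∘ suc) g′ r))))
  where
  lem : ∀ f g₁ x g₀ c₁ c₀ → (f * g₁ + c₁) - x * (f * g₀ + c₀) ≡ f * (g₁ - x * g₀) + (c₁ - x * c₀)
  lem = solve-∀ ring

powersum : List ℕ → ℕ → ℚ
powersum []       k = 0ℚ
powersum (a ∷ as) k = (z a ^ k - t a ^ k) + powersum as k

conv-geometric : ∀ x g r → conv (λ k → x ^ suc k) g (suc r)
  ≡ x * g (suc r) + x * conv (λ k → x ^ suc k) g r
conv-geometric x g r =
  cong₂ (λ y c → y * g (suc r) + c) (*-identityʳ x) (conv-scale x (λ k → x ^ suc k) g r)

-- A new part a multiplies the generating function S of the moments by (1 - yT) / (1 - xT), with x =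
-- z a and y = t a, and adds x / (1 - xT) - y / (1 - yT) to that of the shifted power sums. The
-- series is never differentiated: after multiplication by 1 - xT both sides reduce to the identity
-- for the remaining parts, which gives an induction on the parts with an inner induction on r.
newton : ∀ {as} → Decreasing as → ∀ r →
  fromℕ (suc r) * moment as (suc r) ≡ conv (powersum as ∘ suc) (moment as) r
newton [] r =
  trans (cong (λ x → fromℕ (suc r) * x ^ suc r) z-0)
    (trans (lem (fromℕ (suc r)) (0ℚ ^ r)) (sym (conv-0 (moment []) r)))
  where
  lem : ∀ x y → x * (0ℚ * y) ≡ 0ℚ
  lem = solve-∀ ring
newton {a ∷ as} dec@(cons 0<a as<a dec′) = go
  where
  open ≡-Reasoning
  S = moment (a ∷ as)
  S′ = moment as
  p = powersum as ∘ suc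
  x = z a
  y = t a

  S₀ : S 0 ≡ S′ 0
  S₀ = trans (moment-0 dec) (sym (moment-0 dec′))

  shift : ∀ r → S (suc r) - x * S r ≡ S′ (suc r) - y * S′ r
  shift r = trans (cong (_- x * S r) (moment-cons dec r)) (lem (x * S r) (S′ (suc r) - y * S′ r))
    where
    lem : ∀ m n → (m + n) - m ≡ n
    lem = solve-∀ ring

  split : ∀ r → conv (powersum (a ∷ as) ∘ suc) S r
              ≡ (conv p S r + conv (λ k → x ^ suc k) S r) + (- 1ℚ) * conv (λ k → y ^ suc k) S r
  split r = begin
    conv (powersum (a ∷ as) ∘ suc) S r ≡⟨ conv-cong S r (λ k → lem (x ^ suc k) (y ^ suc k) (p k)) ⟩
    conv (λ k → (p k + x ^ suc k) + (- 1ℚ) * y ^ suc k) S r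
      ≡⟨ conv-add (λ k → p k + x ^ suc k) (λ k → (- 1ℚ) * y ^ suc k) S r ⟩
    conv (λ k → p k + x ^ suc k) S r + conv (λ k → (- 1ℚ) * y ^ suc k) S r
      ≡⟨ cong₂ _+_ (conv-add p (λ k → x ^ suc k) S r) (conv-scale (- 1ℚ) (λ k → y ^ suc k) S r) ⟩
    _ ∎
    where
    lem : ∀ x y p → (x - y) + p ≡ (p + x) + (- 1ℚ) * y
    lem = solve-∀ ring

  -- The factor 1 - yT of S cancels the geometric series y / (1 - yT), leaving y S′ / (1 - xT).
  y-part : ∀ r → conv (λ k → y ^ suc k) S (suc r) ≡ x * conv (λ k → y ^ suc k) S r + y * S′ (suc r)
  y-part r = begin
    C S (suc r)                                       ≡⟨ lem₁ (C S (suc r)) (x * C S r) ⟩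
    x * C S r + (C S (suc r) - x * C S r)
      ≡⟨ cong (x * C S r +_) (conv-shift x y (λ k → y ^ suc k) S S′ S₀ shift r) ⟩
    x * C S r + (C S′ (suc r) - y * C S′ r)
      ≡⟨ cong (λ c → x * C S r + (c - y * C S′ r)) (conv-geometric y S′ r) ⟩
    x * C S r + (y * S′ (suc r) + y * C S′ r - y * C S′ r)
      ≡⟨ lem₂ (x * C S r) (y * S′ (suc r)) (y * C S′ r) ⟩
    x * C S r + y * S′ (suc r)                        ∎
    where
    C = conv (λ k → y ^ suc k)
    lem₁ : ∀ m n → m ≡ n + (m - n)
    lem₁ = solve-∀ ring
    lem₂ : ∀ m n o → m + (n + o - o) ≡ m + n
    lem₂ = solve-∀ ring

  go : ∀ r → fromℕ (suc r) * S (suc r) ≡ conv (powersum (a ∷ as) ∘ suc) S r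
  go zero = begin
    fromℕ 1 * S 1 ≡⟨ cong (_* S 1) fromℕ-1 ⟩
    1ℚ * S 1 ≡⟨ cong (1ℚ *_) (moment-cons dec 0) ⟩
    1ℚ * (x * S 0 + (S′ 1 - y * S′ 0)) ≡⟨ lem₁ x (S 0) (S′ 1) (y * S′ 0) ⟩
    1ℚ * S′ 1 + (x * S 0 - y * S′ 0)
      ≡⟨ cong₂ _+_
        (trans (cong (_* S′ 1) (sym fromℕ-1)) (newton dec′ 0)) (cong (λ s → x * S 0 - y * s) (sym S₀)) ⟩
    p 0 * S′ 0 + (x * S 0 - y * S 0) ≡⟨ cong (λ s → p 0 * s + (x * S 0 - y * S 0)) (sym S₀) ⟩
    p 0 * S 0 + (x * S 0 - y * S 0) ≡⟨ lem₂ x y (p 0) (S 0) ⟩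
    ((x * 1ℚ - y * 1ℚ) + p 0) * S 0 ∎
    where
    lem₁ : ∀ x s s₁ w → 1ℚ * (x * s + (s₁ - w)) ≡ 1ℚ * s₁ + (x * s - w)
    lem₁ = solve-∀ ring
    lem₂ : ∀ x y p s → p * s + (x * s - y * s) ≡ ((x * 1ℚ - y * 1ℚ) + p) * s
    lem₂ = solve-∀ ring
  go (suc r) = sym (begin
    conv (powersum (a ∷ as) ∘ suc) S (suc r) ≡⟨ split (suc r) ⟩
    (conv p S (suc r) + X (suc r)) + (- 1ℚ) * Y (suc r)
      ≡⟨ cong₂ (λ m n → (conv p S (suc r) + m) + (- 1ℚ) * n) (conv-geometric x S r) (y-part r) ⟩
    (conv p S (suc r) + (x * S (suc r) + x * X r)) + (- 1ℚ) * (x * Y r + y * S′ (suc r))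
      ≡⟨ lem₁ (conv p S (suc r)) x (conv p S r) (S (suc r)) (X r) (Y r) (y * S′ (suc r)) ⟩
    (conv p S (suc r) - x * conv p S r) + x * ((conv p S r + X r) + (- 1ℚ) * Y r) + x * S
      (suc r) - y * S′ (suc r)
      ≡⟨ cong₂ (λ m n → m + x * n + x * S (suc r) - y * S′ (suc r)) (conv-shift x y p S S′ S₀ shift r)
           (trans (sym (split r)) (sym (go r))) ⟩
    (conv p S′ (suc r) - y * conv p S′ r) + x * (n * S (suc r)) + x * S (suc r) - y * S′ (suc r)
      ≡⟨ cong₂ (λ m o → (m - y * o) + x * (n * S (suc r)) + x * S (suc r) - y * S′ (suc r))
           (sym (newton dec′ (suc r))) (sym (newton dec′ r)) ⟩
    (fromℕ (suc (suc r)) * S′ (suc (suc r)) - y * (n * S′ (suc r))) + x * (n * S (suc r)) + x * S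
      (suc r) - y * S′ (suc r)
      ≡⟨ cong (λ m → (m * S′ (suc (suc r)) - y * (n * S′ (suc r))) + x * (n * S (suc r)) + x * S
        (suc r) - y * S′ (suc r)) (fromℕ-suc (suc r)) ⟩
    ((1ℚ + n) * S′ (suc (suc r)) - y * (n * S′ (suc r))) + x * (n * S (suc r)) + x * S (suc r) - y * S′
      (suc r)
      ≡⟨ lem₂ n (S′ (suc (suc r))) y (S′ (suc r)) x (S (suc r)) ⟩
    (1ℚ + n) * (x * S (suc r) + (S′ (suc (suc r)) - y * S′ (suc r)))
      ≡⟨ cong₂ _*_ (sym (fromℕ-suc (suc r))) (sym (moment-cons dec (suc r))) ⟩
    fromℕ (suc (suc r)) * S (suc (suc r)) ∎)
    where
    n = fromℕ (suc r)
    X = conv (λ k → x ^ suc k) S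
    Y = conv (λ k → y ^ suc k) S
    lem₁ : ∀ c₁ x c₀ s X Y w → (c₁ + (x * s + x * X)) + (- 1ℚ) * (x * Y + w)
      ≡ (c₁ - x * c₀) + x * ((c₀ + X) + (- 1ℚ) * Y) + x * s - w
    lem₁ = solve-∀ ring
    lem₂ : ∀ n s₂ y s₁ x s → ((1ℚ + n) * s₂ - y * (n * s₁)) + x * (n * s) + x * s - y * s₁
      ≡ (1ℚ + n) * (x * s + (s₂ - y * s₁))
    lem₂ = solve-∀ ring

-- Weighted polynomials in the power sums

psprod : List ℕ → List ℕ → ℚ
psprod []       as = 1ℚ
psprod (k ∷ ks) as = powersum as k * psprod ks as

-- F agrees on strict partitions with a polynomial in the power sums p_1, p_2, …, all of whose
-- monomials have weight less than n, where p_k has weight k.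
data Poly (n : ℕ) : (List ℕ → ℚ) → Set where
  null : Poly n (λ _ → 0ℚ)
  mono : ∀ c {ks} → All (0 ℕ.<_) ks → sum ks ℕ.< n → Poly n (λ as → c * psprod ks as)
  _⊕_  : ∀ {F G} → Poly n F → Poly n G → Poly n (λ as → F as + G as)
  resp : ∀ {F G} → (∀ {as} → Decreasing as → F as ≡ G as) → Poly n F → Poly n G

weaken : ∀ {m n F} → m ℕ.≤ n → Poly m F → Poly n F
weaken m≤n null            = null
weaken m≤n (mono c pos lt) = mono c pos (ℕₚ.<-≤-trans lt m≤n)
weaken m≤n (F ⊕ G)         = weaken m≤n F ⊕ weaken m≤n G
weaken m≤n (resp h F)      = resp h (weaken m≤n F)

psprod-++ : ∀ ks ls as → psprod (ks ++ ls) as ≡ psprod ks as * psprod ls as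
psprod-++ []       ls as = sym (*-identityˡ (psprod ls as))
psprod-++ (k ∷ ks) ls as =
  trans (cong (powersum as k *_) (psprod-++ ks ls as))
    (sym (*-assoc (powersum as k) (psprod ks as) (psprod ls as)))

infixl 6 _⊕_
infixl 7 _⊛_ _⊛ᶻ_
-- The indices are strict bounds: weights at most m and less than n add up to less than m + n.
-- Writing `suc m` only on the left lets the right factor have bound 0, the zero polynomial, which
-- occurs in `E-psprodΔ` for an empty product.
_⊛_ : ∀ {m n F G} → Poly (suc m) F → Poly n G → Poly (m ℕ.+ n) (λ as → F as * G as)
_⊛_ {G = G} null Q = resp (λ {as} _ → sym (*-zeroˡ (G as))) null
_⊛_ {G = G} (_⊕_ {F} {F′} P P′) Q =
  resp (λ {as} _ → sym (*-distribʳ-+ (G as) (F as) (F′ as))) (P ⊛ Q ⊕ P′ ⊛ Q)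
_⊛_ {G = G} (resp h P) Q = resp (λ {as} dec → cong (_* G as) (h dec)) (P ⊛ Q)
_⊛_ {F = F} P@(mono _ _ _) null = resp (λ {as} _ → sym (*-zeroʳ (F as))) null
_⊛_ {F = F} P@(mono _ _ _) (_⊕_ {G} {G′} Q Q′) =
  resp (λ {as} _ → sym (*-distribˡ-+ (F as) (G as) (G′ as))) (P ⊛ Q ⊕ P ⊛ Q′)
_⊛_ {F = F} P@(mono _ _ _) (resp h Q) = resp (λ {as} dec → cong (F as *_) (h dec)) (P ⊛ Q)
_⊛_ {m} {n} (mono c {ks} pos lt) (mono d {ls} pos′ lt′) =
  resp (λ {as} _ → trans (cong (c * d *_) (psprod-++ ks ls as)) (lem c d (psprod ks as) (psprod ls as)))
    (mono (c * d) (Allₚ.++⁺ pos pos′)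
      (subst (ℕ._< m ℕ.+ n) (sym (sum-++ ks ls)) (ℕₚ.+-mono-≤-< (ℕₚ.≤-pred lt) lt′)))
  where
  lem : ∀ c d x y → c * d * (x * y) ≡ c * x * (d * y)
  lem = solve-∀ ring

scaleₚ : ∀ {n F} c → Poly n F → Poly n (λ as → c * F as)
scaleₚ {F = F} c P = resp (λ {as} _ → cong (_* F as) (*-identityʳ c)) (mono {1} c [] (ℕ.s≤s ℕ.z≤n) ⊛ P)

powersum-poly : ∀ k → 0 ℕ.< k → Poly (suc k) (λ as → powersum as k)
powersum-poly k 0<k = resp (λ {as} _ → lem (powersum as k))
  (mono 1ℚ (0<k ∷ []) (ℕ.s≤s (ℕₚ.≤-reflexive (ℕₚ.+-identityʳ k))))
  where
  lem : ∀ x → 1ℚ * (x * 1ℚ) ≡ x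
  lem = solve-∀ ring

psprod-poly : ∀ {ks} → All (0 ℕ.<_) ks → Poly (suc (sum ks)) (psprod ks)
psprod-poly {ks} pos = resp (λ {as} _ → *-identityˡ (psprod ks as)) (mono 1ℚ pos (ℕₚ.n<1+n (sum ks)))

-- In the term of f k the weights w + k and r - k add up to w + r whatever k is. The offset w
-- absorbs the shift of f at each step of `conv`.
conv-poly : ∀ {f g : ℕ → List ℕ → ℚ} w r → (∀ k → Poly (suc (w ℕ.+ k)) (f k)) →
  (∀ i → i ℕ.≤ r → Poly (suc i) (g i)) → Poly (suc (w ℕ.+ r)) (λ as → conv (λ k → f k as)
    (λ i → g i as) r)
conv-poly w zero    F G =
  weaken (ℕₚ.≤-reflexive (trans (cong (ℕ._+ 1) (ℕₚ.+-identityʳ w))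
    (trans (ℕₚ.+-comm w 1) (cong suc (sym (ℕₚ.+-identityʳ w))))))
  (F 0 ⊛ G 0 ℕ.z≤n)
conv-poly {f} w (suc r) F G =
  weaken (ℕₚ.≤-reflexive
    (trans (cong (ℕ._+ suc (suc r)) (ℕₚ.+-identityʳ w)) (ℕₚ.+-suc w (suc r)))) (F 0 ⊛ G
      (suc r) ℕₚ.≤-refl)
  ⊕ weaken (ℕₚ.≤-reflexive (cong suc (sym (ℕₚ.+-suc w r))))
      (conv-poly (suc w) r (λ k → subst (λ m → Poly (suc m) (f (suc k))) (ℕₚ.+-suc w k) (F (suc k)))
        (λ i i≤r → G i (ℕₚ.m≤n⇒m≤1+n i≤r)))

moment-poly : ∀ r → Poly (suc r) (λ as → moment as r)
moment-poly r = go r r ℕₚ.≤-refl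
  where
  -- Newton's identity calls all smaller moments at once, hence the recursion on a bound n for r.
  go : ∀ n r → r ℕ.≤ n → Poly (suc r) (λ as → moment as r)
  go n zero _ = resp (λ dec → sym (moment-0 dec)) (mono 1ℚ [] (ℕ.s≤s ℕ.z≤n))
  go (suc n) (suc r) (ℕ.s≤s r≤n) =
    resp (λ {as} dec → cancelˡ (fromℕ (suc r)) (fromℕ-suc≢0 r)
           (trans (lem (fromℕ (suc r)) (inv (fromℕ (suc r))) (conv (powersum as ∘ suc) (moment as) r))
             (trans (cong (_* conv (powersum as ∘ suc) (moment as) r) (*-inv (fromℕ-suc≢0 r)))
               (trans (*-identityˡ (conv (powersum as ∘ suc) (moment as) r)) (sym (newton dec r))))))
      (scaleₚ (inv (fromℕ (suc r)))
        (conv-poly 1 r (λ k → powersum-poly (suc k) (ℕ.s≤s ℕ.z≤n))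
          (λ i i≤r → go n i (ℕₚ.≤-trans i≤r r≤n))))
    where
    lem : ∀ x i c → x * (i * c) ≡ x * i * c
    lem = solve-∀ ring

-- Polynomials in z, whose degree bounds become weight bounds under E

data ZPoly (n : ℕ) : (ℕ → ℚ) → Set where
  null : ZPoly n (λ _ → 0ℚ)
  mono : ∀ c {j} → j ℕ.< n → ZPoly n (λ b → c * z b ^ j)
  _⊕_  : ∀ {f g} → ZPoly n f → ZPoly n g → ZPoly n (λ b → f b + g b)
  resp : ∀ {f g} → (∀ b → f b ≡ g b) → ZPoly n f → ZPoly n g

weaken-z : ∀ {m n f} → m ℕ.≤ n → ZPoly m f → ZPoly n f
weaken-z m≤n null        = null
weaken-z m≤n (mono c lt) = mono c (ℕₚ.<-≤-trans lt m≤n)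
weaken-z m≤n (f ⊕ g)     = weaken-z m≤n f ⊕ weaken-z m≤n g
weaken-z m≤n (resp h f)  = resp h (weaken-z m≤n f)

_⊛ᶻ_ : ∀ {m n f g} → ZPoly (suc m) f → ZPoly n g → ZPoly (m ℕ.+ n) (λ b → f b * g b)
_⊛ᶻ_ {g = g} null q = resp (λ b → sym (*-zeroˡ (g b))) null
_⊛ᶻ_ {g = g} (_⊕_ {f} {f′} p p′) q =
  resp (λ b → sym (*-distribʳ-+ (g b) (f b) (f′ b))) (p ⊛ᶻ q ⊕ p′ ⊛ᶻ q)
_⊛ᶻ_ {g = g} (resp h p) q = resp (λ b → cong (_* g b) (h b)) (p ⊛ᶻ q)
_⊛ᶻ_ {f = f} p@(mono _ _) null = resp (λ b → sym (*-zeroʳ (f b))) null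
_⊛ᶻ_ {f = f} p@(mono _ _) (_⊕_ {g} {g′} q q′) =
  resp (λ b → sym (*-distribˡ-+ (f b) (g b) (g′ b))) (p ⊛ᶻ q ⊕ p ⊛ᶻ q′)
_⊛ᶻ_ {f = f} p@(mono _ _) (resp h q) = resp (λ b → cong (f b *_) (h b)) (p ⊛ᶻ q)
mono c {i} lt ⊛ᶻ mono d {j} lt′ =
  resp (λ b → trans (cong (c * d *_) (^-homo-* (z b) i j)) (lem c d (z b ^ i) (z b ^ j)))
    (mono (c * d) (ℕₚ.+-mono-≤-< (ℕₚ.≤-pred lt) lt′))
  where
  lem : ∀ c d x y → c * d * (x * y) ≡ c * x * (d * y)
  lem = solve-∀ ring

E-poly : ∀ {n f} → ZPoly n f → Poly n (λ as → E as f)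
E-poly null            = resp (λ {as} _ → sym (E-0 as)) null
E-poly (mono c {j} lt) =
  resp (λ {as} _ → sym (E-scale as c (λ b → z b ^ j))) (scaleₚ c (weaken lt (moment-poly j)))
E-poly (_⊕_ {f} {g} p q) = resp (λ {as} _ → sym (E-+ as f g)) (E-poly p ⊕ E-poly q)
E-poly (resp h f)      = resp (λ {as} _ → E-ext as h) (E-poly f)

-- The increment of p_k when a part b is enlarged to b + 1, a new part 1 corresponding to b = 0.
Δ : ℕ → ℕ → ℚ
Δ k b = (z (suc b) ^ k - z b ^ k) - (z b ^ k - t b ^ k)

-- z (b + 1) and t b are the roots of X² - (2 z b + 1) X + (z b)² - z b.
Δ-suc-suc : ∀ k b → Δ (suc (suc k)) b ≡
  ((1ℚ + 1ℚ) * z b ^ 1 + 1ℚ * z b ^ 0) * Δ (suc k) b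
    + (1ℚ * z b ^ 1 + (- 1ℚ) * z b ^ 2) * Δ k b + ((1ℚ + 1ℚ) * (1ℚ + 1ℚ)) * z b ^ suc k
Δ-suc-suc k b = begin
  Δ (suc (suc k)) b
    ≡⟨ cong₂ (λ x y → (x * (x * A) - z b * (z b * Z)) - (z b * (z b * Z) - y * (y * B))) α β ⟩
  (α′ * (α′ * A) - z b * (z b * Z)) - (z b * (z b * Z) - β′ * (β′ * B))
    ≡⟨ lem (z b) n A Z B ⟩
  R α′ β′ + (n * (1ℚ + n - 1ℚ) + n - (1ℚ + 1ℚ) * z b) * (A + B)
    ≡⟨ cong (λ w → R α′ β′ + w * (A + B)) vanish ⟩
  R α′ β′ + 0ℚ * (A + B)
    ≡⟨ trans (cong (R α′ β′ +_) (*-zeroˡ (A + B))) (+-identityʳ (R α′ β′)) ⟩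
  R α′ β′
    ≡⟨ cong₂ R (sym α) (sym β) ⟩
  R (z (suc b)) (t b) ∎
  where
  open ≡-Reasoning
  n = fromℕ b
  A = z (suc b) ^ k
  Z = z b ^ k
  B = t b ^ k
  α′ = (1ℚ + n) + z b
  β′ = z b - n
  R : ℚ → ℚ → ℚ
  R x y = ((1ℚ + 1ℚ) * (z b * 1ℚ) + 1ℚ * 1ℚ) * ((x * A - z b * Z) - (z b * Z - y * B))
    + (1ℚ * (z b * 1ℚ) + (- 1ℚ) * (z b * (z b * 1ℚ))) * ((A - Z) - (Z - B)) + ((1ℚ + 1ℚ) * (1ℚ + 1ℚ)) *
      (z b * Z)
  α : z (suc b) ≡ α′
  α = trans (z-t (suc b)) (cong (_+ z b) (fromℕ-suc b))
  β : t b ≡ β′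
  β = trans (lem₁ n (t b)) (cong (_- n) (sym (z-t b)))
    where
    lem₁ : ∀ n t → t ≡ (n + t) - n
    lem₁ = solve-∀ ring
  vanish : n * (1ℚ + n - 1ℚ) + n - (1ℚ + 1ℚ) * z b ≡ 0ℚ
  vanish = trans (cong (λ w → n * (1ℚ + n - 1ℚ) + n - w)
    (trans (2*t (suc b)) (cong (λ m → m * (m - 1ℚ)) (fromℕ-suc b))))
                 (lem₂ n)
    where
    lem₂ : ∀ n → n * (1ℚ + n - 1ℚ) + n - (1ℚ + n) * ((1ℚ + n) - 1ℚ) ≡ 0ℚ
    lem₂ = solve-∀ ring
  lem : ∀ z n A Z B →
    (((1ℚ + n) + z) * (((1ℚ + n) + z) * A) - z * (z * Z)) - (z * (z * Z) - (z - n) * ((z - n) * B))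
    ≡ (((1ℚ + 1ℚ) * (z * 1ℚ) + 1ℚ * 1ℚ) * ((((1ℚ + n) + z) * A - z * Z) - (z * Z - (z - n) * B))
        + (1ℚ * (z * 1ℚ) + (- 1ℚ) * (z * (z * 1ℚ))) * ((A - Z) - (Z - B)) + ((1ℚ + 1ℚ) * (1ℚ + 1ℚ)) *
          (z * Z))
      + (n * (1ℚ + n - 1ℚ) + n - (1ℚ + 1ℚ) * z) * (A + B)
  lem = solve-∀ ring

-- The power sums of the two roots satisfy the recurrence of their quadratic exactly; the subtracted
-- 2 z b ^ k leaves the inhomogeneous term 4 z b ^ (k + 1). Since Δ 0 = 0 and Δ 1 = 1, each step of
-- the recurrence raises the degree by at most one, so the degree stays below k.
Δ-poly : ∀ k → ZPoly k (Δ k)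
Δ-poly zero = null
Δ-poly (suc zero) = resp (λ b → begin
    1ℚ * 1ℚ ≡⟨ lem (fromℕ b) (z b) (t b) ⟩
    ((((1ℚ + fromℕ b) + z b) * 1ℚ - z b * 1ℚ) - ((fromℕ b + t b) * 1ℚ - t b * 1ℚ))
      ≡⟨ cong₂ (λ x y → (x * 1ℚ - z b * 1ℚ) - (y * 1ℚ - t b * 1ℚ))
           (sym (trans (z-t (suc b)) (cong (_+ z b) (fromℕ-suc b)))) (sym (z-t b)) ⟩
    Δ 1 b ∎) (mono 1ℚ {0} (ℕ.s≤s ℕ.z≤n))
  where
  open ≡-Reasoning
  lem : ∀ n z t → 1ℚ * 1ℚ ≡ ((((1ℚ + n) + z) * 1ℚ - z * 1ℚ) - ((n + t) * 1ℚ - t * 1ℚ))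
  lem = solve-∀ ring
Δ-poly (suc (suc k)) = resp (λ b → sym (Δ-suc-suc k b))
  (((mono {2} (1ℚ + 1ℚ) {1} ℕₚ.≤-refl ⊕ mono 1ℚ {0} (ℕ.s≤s ℕ.z≤n)) ⊛ᶻ Δ-poly (suc k)
    ⊕ ((mono {3} 1ℚ {1} (ℕ.s≤s (ℕ.s≤s ℕ.z≤n)) ⊕ mono (- 1ℚ) {2} ℕₚ.≤-refl) ⊛ᶻ Δ-poly k))
    ⊕ mono ((1ℚ + 1ℚ) * (1ℚ + 1ℚ)) {suc k} ℕₚ.≤-refl)

-- The loss of weight for products of power sums

psprodΔ : List ℕ → List ℕ → ℕ → ℚ
psprodΔ []       as b = 1ℚ
psprodΔ (k ∷ ks) as b = (powersum as k + Δ k b) * psprodΔ ks as b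

-- Splitting off the first factor leaves p (S - Q), Δ (S - Q) and Q Δ, where S and Q are the
-- enlarged and the old product of the other factors. In the second term Δ depends on b and cannot
-- be taken out of `E`, so the induction carries a polynomial multiplier f. Weight is lost when Δ k,
-- of degree below k, takes the place of p_k.
E-psprodΔ : ∀ {ks} → All (0 ℕ.<_) ks → ∀ {n f} → ZPoly (suc n) f →
  Poly (n ℕ.+ sum ks) (λ as → E as (λ b → f b * (psprodΔ ks as b - psprod ks as)))
E-psprodΔ [] {f = f} _ = resp (λ {as} _ → sym (trans (E-ext as (λ b → lem (f b))) (E-0 as))) null
  where
  lem : ∀ f → f * (1ℚ - 1ℚ) ≡ 0ℚ
  lem = solve-∀ ring
E-psprodΔ {suc k ∷ ks} (0<k ∷ pos) {n} {f} F = resp (λ {as} _ → sym (split as))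
  (weaken (ℕₚ.≤-reflexive (trans (sym (ℕₚ.+-assoc (suc k) n s))
    (trans (cong (ℕ._+ s) (ℕₚ.+-comm (suc k) n)) (ℕₚ.+-assoc n (suc k) s))))
    (powersum-poly (suc k) 0<k ⊛ E-psprodΔ pos F)
   ⊕ weaken (ℕₚ.≤-trans (ℕₚ.n≤1+n _) (ℕₚ.≤-reflexive
     (trans (cong (ℕ._+ s) (sym (ℕₚ.+-suc n k))) (ℕₚ.+-assoc n (suc k) s))))
      (E-psprodΔ pos FΔ)
   ⊕ weaken (ℕₚ.≤-reflexive (trans (ℕₚ.+-comm s (n ℕ.+ suc k)) (ℕₚ.+-assoc n (suc k) s)))
      (psprod-poly pos ⊛ E-poly (F ⊛ᶻ Δ-poly (suc k))))
  where
  open ≡-Reasoning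
  s = sum ks
  FΔ : ZPoly (suc (n ℕ.+ k)) (λ b → f b * Δ (suc k) b)
  FΔ = weaken-z (ℕₚ.≤-reflexive (ℕₚ.+-suc n k)) (F ⊛ᶻ Δ-poly (suc k))
  lem : ∀ f p D S Q → f * ((p + D) * S - p * Q) ≡ (p * (f * (S - Q)) + (f * D) * (S - Q)) + Q * (f * D)
  lem = solve-∀ ring
  split : ∀ as → E as (λ b → f b * (psprodΔ (suc k ∷ ks) as b - psprod (suc k ∷ ks) as))
    ≡ powersum as (suc k) * E as (λ b → f b * (psprodΔ ks as b - psprod ks as))
      + E as (λ b → (f b * Δ (suc k) b) * (psprodΔ ks as b - psprod ks as))
      + psprod ks as * E as (λ b → f b * Δ (suc k) b)
  split as = begin
    E as (λ b → f b * (psprodΔ (suc k ∷ ks) as b - p * Q))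
      ≡⟨ E-ext as (λ b → lem (f b) p (Δ (suc k) b) (psprodΔ ks as b) Q) ⟩
    E as (λ b → (p * e₁ b + e₂ b) + Q * e₃ b)
      ≡⟨ E-+ as (λ b → p * e₁ b + e₂ b) (λ b → Q * e₃ b) ⟩
    E as (λ b → p * e₁ b + e₂ b) + E as (λ b → Q * e₃ b)
      ≡⟨ cong₂ _+_
        (trans (E-+ as (λ b → p * e₁ b) e₂) (cong (_+ E as e₂) (E-scale as p e₁))) (E-scale as Q e₃) ⟩
    p * E as e₁ + E as e₂ + Q * E as e₃ ∎
    where
    p = powersum as (suc k)
    Q = psprod ks as
    e₁ e₂ e₃ : ℕ → ℚ
    e₁ b = f b * (psprodΔ ks as b - Q)
    e₂ b = (f b * Δ (suc k) b) * (psprodΔ ks as b - Q)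
    e₃ b = f b * Δ (suc k) b

-- From quotients of hook products to the functional E

2≢0 : 2ℚ ≢ 0ℚ
2≢0 ()

*-≢0 : ∀ {x y} → x ≢ 0ℚ → y ≢ 0ℚ → x * y ≢ 0ℚ
*-≢0 {x} {y} x≢0 y≢0 eq = y≢0 (cancelˡ x x≢0 (trans eq (sym (*-zeroʳ x))))

inv-* : ∀ {x y} → x ≢ 0ℚ → y ≢ 0ℚ → inv (x * y) ≡ inv x * inv y
inv-* {x} {y} x≢0 y≢0 = cancelˡ (x * y) (*-≢0 x≢0 y≢0) (trans (*-inv (*-≢0 x≢0 y≢0))
  (sym (trans (lem x y (inv x) (inv y)) (trans (cong₂ _*_ (*-inv x≢0) (*-inv y≢0)) (*-identityˡ 1ℚ)))))
  where
  lem : ∀ x y i j → x * y * (i * j) ≡ (x * i) * (y * j)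
  lem = solve-∀ ring

cross : ∀ {x₁ y₁ x₂ y₂ n d} → y₁ ≢ 0ℚ → y₂ ≢ 0ℚ → d ≢ 0ℚ → x₁ * y₂ * d ≡ x₂ * n * y₁ →
  x₁ * inv y₁ ≡ x₂ * inv y₂ * (n * inv d)
cross {x₁} {y₁} {x₂} {y₂} {n} {d} y₁≢0 y₂≢0 d≢0 eq = begin
  x₁ * inv y₁                                       ≡⟨ lem₁ (x₁ * inv y₁) ⟩
  x₁ * inv y₁ * (1ℚ * 1ℚ)
    ≡⟨ cong₂ (λ u v → x₁ * inv y₁ * (u * v)) (*-inv y₂≢0) (*-inv d≢0) ⟨
  x₁ * inv y₁ * ((y₂ * inv y₂) * (d * inv d))       ≡⟨ lem₂ x₁ (inv y₁) y₂ (inv y₂) d (inv d) ⟩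
  (x₁ * y₂ * d) * (inv y₁ * inv y₂ * inv d)         ≡⟨ cong (_* (inv y₁ * inv y₂ * inv d)) eq ⟩
  (x₂ * n * y₁) * (inv y₁ * inv y₂ * inv d)         ≡⟨ lem₃ x₂ n y₁ (inv y₁) (inv y₂) (inv d) ⟩
  (y₁ * inv y₁) * (x₂ * inv y₂ * (n * inv d))
    ≡⟨ cong (_* (x₂ * inv y₂ * (n * inv d))) (*-inv y₁≢0) ⟩
  1ℚ * (x₂ * inv y₂ * (n * inv d))                  ≡⟨ *-identityˡ (x₂ * inv y₂ * (n * inv d)) ⟩
  x₂ * inv y₂ * (n * inv d)                         ∎
  where
  open ≡-Reasoning
  lem₁ : ∀ x → x ≡ x * (1ℚ * 1ℚ)
  lem₁ = solve-∀ ring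
  lem₂ : ∀ x i y j d k → x * i * ((y * j) * (d * k)) ≡ (x * y * d) * (i * j * k)
  lem₂ = solve-∀ ring
  lem₃ : ∀ x n y i j k → (x * n * y) * (i * j * k) ≡ (y * i) * (x * j * (n * k))
  lem₃ = solve-∀ ring

fromℕ-≢0 : ∀ {n} → 0 ℕ.< n → fromℕ n ≢ 0ℚ
fromℕ-≢0 {suc n} _ = fromℕ-suc≢0 n

1+A+B≢0 : ∀ a b → 1ℚ + fromℕ a + fromℕ b ≢ 0ℚ
1+A+B≢0 a b eq =
  fromℕ-suc≢0 (a ℕ.+ b) (trans (trans (fromℕ-+ (suc a) b) (cong (_+ fromℕ b) (fromℕ-suc a))) eq)

A+B≢0 : ∀ {a} b → 0 ℕ.< a → fromℕ a + fromℕ b ≢ 0ℚ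
A+B≢0 {a} b 0<a eq = fromℕ-≢0 (ℕₚ.<-≤-trans 0<a (ℕₚ.m≤m+n a b)) (trans (fromℕ-+ a b) eq)

2*z : ∀ b → 2ℚ * z b ≡ (1ℚ + fromℕ b) * fromℕ b
2*z b = trans (2*t (suc b)) (trans (cong (λ m → m * (m - 1ℚ)) (fromℕ-suc b)) (lem (fromℕ b)))
  where
  lem : ∀ n → (1ℚ + n) * ((1ℚ + n) - 1ℚ) ≡ (1ℚ + n) * n
  lem = solve-∀ ring

-- Differences of triangular numbers split into linear factors. With `2*[z-t]` this gives (z b - t
-- a) / (z b - z a) = (a - b - 1) (a + b) / ((a - b) (a + b + 1)), the change of the factor (a - b)
-- / (a + b) of the inverse hook product when b grows by one.
2*[z-z] : ∀ b a → 2ℚ * (z b - z a) ≡ - ((fromℕ a - fromℕ b) * (1ℚ + fromℕ a + fromℕ b))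
2*[z-z] b a = trans (lem₁ 2ℚ (z b) (z a)) (trans (cong₂ _-_ (2*z b) (2*z a)) (lem₂ (fromℕ a) (fromℕ b)))
  where
  lem₁ : ∀ k x y → k * (x - y) ≡ k * x - k * y
  lem₁ = solve-∀ ring
  lem₂ : ∀ A B → (1ℚ + B) * B - (1ℚ + A) * A ≡ - ((A - B) * (1ℚ + A + B))
  lem₂ = solve-∀ ring

2*[z-t] : ∀ b a → 2ℚ * (z b - t a) ≡ - ((fromℕ a - (1ℚ + fromℕ b)) * (fromℕ a + fromℕ b))
2*[z-t] b a = trans (lem₁ 2ℚ (z b) (t a)) (trans (cong₂ _-_ (2*z b) (2*t a)) (lem₂ (fromℕ a) (fromℕ b)))
  where
  lem₁ : ∀ k x y → k * (x - y) ≡ k * x - k * y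
  lem₁ = solve-∀ ring
  lem₂ : ∀ A B → (1ℚ + B) * B - A * (A - 1ℚ) ≡ - ((A - (1ℚ + B)) * (A + B))
  lem₂ = solve-∀ ring

-- The enlarged list may have two equal parts; in sums weighted by `hookInv` such lists contribute
-- 0, see `increment-strict`.
data Increment : List ℕ → ℕ → List ℕ → Set where
  new   : Increment [] 0 (1 ∷ [])
  here  : ∀ {a as} → Increment (a ∷ as) a (suc a ∷ as)
  there : ∀ {a as b bs} → Increment as b bs → Increment (a ∷ as) b (a ∷ bs)

-- The sum over all ways to add a box to the end of a row, with the weights of D; the first
-- argument of f is the part enlarged, 0 for a new row.
addSum : (ℕ → List ℕ → ℚ) → List ℕ → ℚ
addSum f []       = f 0 (1 ∷ [])
addSum f (a ∷ as) = 2ℚ * f a (suc a ∷ as) + addSum (λ b bs → f b (a ∷ bs)) as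

addSum-cong : ∀ {f g} as → (∀ {b bs} → Increment as b bs → f b bs ≡ g b bs) → addSum f as ≡ addSum g as
addSum-cong []       h = h new
addSum-cong (a ∷ as) h = cong₂ (λ x y → 2ℚ * x + y) (h here) (addSum-cong as (h ∘ there))

addSum-scale : ∀ k f as → addSum (λ b bs → k * f b bs) as ≡ k * addSum f as
addSum-scale k f []       = refl
addSum-scale k f (a ∷ as) =
  trans (cong (2ℚ * (k * f a (suc a ∷ as)) +_) (addSum-scale k (λ b bs → f b (a ∷ bs)) as))
  (lem k 2ℚ (f a (suc a ∷ as)) (addSum (λ b bs → f b (a ∷ bs)) as))
  where
  lem : ∀ k t x y → t * (k * x) + k * y ≡ k * (t * x + y)
  lem = solve-∀ ring

-- The inverse of the product of the hook lengths of a first row a above the rows as.  It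
-- vanishes when a occurs in as.
rowInv : ℕ → List ℕ → ℚ
rowInv a []       = inv (fromℕ (a !))
rowInv a (b ∷ bs) = rowInv a bs * ((fromℕ a - fromℕ b) * inv (fromℕ a + fromℕ b))

-- The closed form Π 1 / λ_i! · Π_{i<j} (λ_i - λ_j) / (λ_i + λ_j) of 1 / H_λ.
hookInv : List ℕ → ℚ
hookInv []       = 1ℚ
hookInv (a ∷ as) = rowInv a as * hookInv as

factor-inc : ∀ {a b} → b ℕ.< a →
  (fromℕ a - fromℕ (suc b)) * inv (fromℕ a + fromℕ (suc b))
    ≡ (fromℕ a - fromℕ b) * inv (fromℕ a + fromℕ b) * ((z b - t a) * inv (z b - z a))
factor-inc {a} {b} b<a = trans
  (cong₂ (λ x y → x * inv y) (cong (λ x → A - x) (fromℕ-suc b))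
    (trans (cong (A +_) (fromℕ-suc b)) (lem₀ A B)))
  (cross {x₁ =
    A - (1ℚ + B)} {x₂ =
      A - B} {n = z b - t a} (1+A+B≢0 a b) (A+B≢0 b (ℕₚ.≤-<-trans ℕ.z≤n b<a)) (z-≢ b<a)
    (cancelˡ 2ℚ 2≢0 (begin
      2ℚ * ((A - (1ℚ + B)) * (A + B) * (z b - z a)) ≡⟨ lem₁ 2ℚ ((A - (1ℚ + B)) * (A + B)) (z b - z a) ⟩
      (A - (1ℚ + B)) * (A + B) * (2ℚ * (z b - z a))
        ≡⟨ cong ((A - (1ℚ + B)) * (A + B) *_) (2*[z-z] b a) ⟩
      (A - (1ℚ + B)) * (A + B) * - ((A - B) * (1ℚ + A + B)) ≡⟨ lem₂ A B ⟩
      (A - B) * - ((A - (1ℚ + B)) * (A + B)) * (1ℚ + A + B)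
        ≡⟨ cong (λ x → (A - B) * x * (1ℚ + A + B)) (2*[z-t] b a) ⟨
      (A - B) * (2ℚ * (z b - t a)) * (1ℚ + A + B) ≡⟨ lem₃ 2ℚ (A - B) (z b - t a) (1ℚ + A + B) ⟩
      2ℚ * ((A - B) * (z b - t a) * (1ℚ + A + B)) ∎)))
  where
  open ≡-Reasoning
  A = fromℕ a
  B = fromℕ b
  lem₀ : ∀ A B → A + (1ℚ + B) ≡ 1ℚ + A + B
  lem₀ = solve-∀ ring
  lem₁ : ∀ k x y → k * (x * y) ≡ x * (k * y)
  lem₁ = solve-∀ ring
  lem₂ : ∀ A B → (A - (1ℚ + B)) * (A + B) * - ((A - B) * (1ℚ + A + B))
    ≡ (A - B) * - ((A - (1ℚ + B)) * (A + B)) * (1ℚ + A + B)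
  lem₂ = solve-∀ ring
  lem₃ : ∀ k x y w → x * (k * y) * w ≡ k * (x * y * w)
  lem₃ = solve-∀ ring

factor-suc : ∀ {c a} → a ℕ.< c →
  (fromℕ (suc c) - fromℕ a) * inv (fromℕ (suc c) + fromℕ a)
    ≡ (fromℕ c - fromℕ a) * inv (fromℕ c + fromℕ a) * ((t a - z c) * inv (z a - z c))
factor-suc {c} {a} a<c = trans
  (cong (λ x → (x - A) * inv (x + A)) (fromℕ-suc c))
  (cross {x₁ =
    (1ℚ + K) - A} {x₂ =
      K - A} {n = t a - z c} (1+A+B≢0 c a) (A+B≢0 a (ℕₚ.≤-<-trans ℕ.z≤n a<c)) (z-≢ a<c)
    (cancelˡ 2ℚ 2≢0 (begin
      2ℚ * (((1ℚ + K) - A) * (K + A) * (z a - z c)) ≡⟨ lem₁ 2ℚ (((1ℚ + K) - A) * (K + A)) (z a - z c) ⟩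
      ((1ℚ + K) - A) * (K + A) * (2ℚ * (z a - z c))
        ≡⟨ cong (((1ℚ + K) - A) * (K + A) *_) (2*[z-z] a c) ⟩
      ((1ℚ + K) - A) * (K + A) * - ((K - A) * (1ℚ + K + A)) ≡⟨ lem₂ K A ⟩
      (K - A) * - (- ((A - (1ℚ + K)) * (A + K))) * (1ℚ + K + A)
        ≡⟨ cong (λ x → (K - A) * - x * (1ℚ + K + A)) (2*[z-t] c a) ⟨
      (K - A) * - (2ℚ * (z c - t a)) * (1ℚ + K + A) ≡⟨ lem₃ 2ℚ (K - A) (z c) (t a) (1ℚ + K + A) ⟩
      2ℚ * ((K - A) * (t a - z c) * (1ℚ + K + A)) ∎)))
  where
  open ≡-Reasoning
  A = fromℕ a
  K = fromℕ c
  lem₁ : ∀ k x y → k * (x * y) ≡ x * (k * y)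
  lem₁ = solve-∀ ring
  lem₂ : ∀ K A → ((1ℚ + K) - A) * (K + A) * - ((K - A) * (1ℚ + K + A))
    ≡ (K - A) * - (- ((A - (1ℚ + K)) * (A + K))) * (1ℚ + K + A)
  lem₂ = solve-∀ ring
  lem₃ : ∀ k x y u w → x * - (k * (y - u)) * w ≡ k * (x * (u - y) * w)
  lem₃ = solve-∀ ring

rowInv-inc : ∀ {a as b bs} → 0 ℕ.< a → All (ℕ._< a) as → Increment as b bs →
  rowInv a bs ≡ rowInv a as * ((z b - t a) * inv (z b - z a))
-- An absent row behaves like a part 0, whose factor (a - 0) / (a + 0) is 1.
rowInv-inc {a} 0<a [] new = cong (rowInv a [] *_) (trans (factor-inc 0<a)
  (trans (cong (_* ((z 0 - t a) * inv (z 0 - z a))) unit) (*-identityˡ ((z 0 - t a) * inv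
    (z 0 - z a)))))
  where
  unit : (fromℕ a - fromℕ 0) * inv (fromℕ a + fromℕ 0) ≡ 1ℚ
  unit = trans (cong₂ (λ x y → x * inv y)
    (trans (cong (λ x → fromℕ a - x) fromℕ-0) (+-identityʳ (fromℕ a)))
                                           (trans (cong (fromℕ a +_) fromℕ-0) (+-identityʳ (fromℕ a))))
               (*-inv (fromℕ-≢0 0<a))
rowInv-inc {a} {b ∷ as} 0<a (b<a ∷ _) here =
  trans (cong (rowInv a as *_) (factor-inc b<a))
        (sym (*-assoc (rowInv a as) ((fromℕ a - fromℕ b) * inv (fromℕ a + fromℕ b)) ((z b - t a) * inv
          (z b - z a))))
rowInv-inc {a} {c ∷ as} {b} 0<a (_ ∷ as<a) (there inc) =
  trans (cong (_* ρ) (rowInv-inc 0<a as<a inc)) (lem (rowInv a as) _ ρ)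
  where
  ρ = (fromℕ a - fromℕ c) * inv (fromℕ a + fromℕ c)
  lem : ∀ x y ρ → x * y * ρ ≡ x * ρ * y
  lem = solve-∀ ring

-- With R the rational function belonging to `as`, the value of `E as` on 1 / (z b - z c) is -R(z
-- c), and c = z c - t c, so the left side carries the residue c R(z c) of the pole that the part c
-- creates. Below a, the function 1 / (z b - z c) is an eigenfunction of `dd a`, and its eigenvalue
-- is the quotient in `factor-suc`. The base case c / z c = 2 / (c + 1) is where the coefficient 2
-- of D comes from.
rowInv-suc : ∀ {c as} → 0 ℕ.< c → All (ℕ._< c) as → Decreasing as →
  - fromℕ c * E as (λ b → inv (z b - z c)) * rowInv c as ≡ 2ℚ * rowInv (suc c) as
rowInv-suc {c} {[]} 0<c _ _ = begin
  - K * inv d * inv (fromℕ (c !)) ≡⟨ cong (_* inv (fromℕ (c !))) (sym eq) ⟩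
  2ℚ * inv (1ℚ + K) * inv (fromℕ (c !)) ≡⟨ *-assoc 2ℚ (inv (1ℚ + K)) (inv (fromℕ (c !))) ⟩
  2ℚ * (inv (1ℚ + K) * inv (fromℕ (c !)))
    ≡⟨ cong (2ℚ *_) (inv-* 1+K≢0 (fromℕ-≢0 (ℕ.>-nonZero⁻¹ (c !) {{c ℕₚ.!≢0}}))) ⟨
  2ℚ * inv ((1ℚ + K) * fromℕ (c !)) ≡⟨ cong (λ x → 2ℚ * inv (x * fromℕ (c !))) (fromℕ-suc c) ⟨
  2ℚ * inv (fromℕ (suc c) * fromℕ (c !)) ≡⟨ cong (λ x → 2ℚ * inv x) (fromℕ-* (suc c) (c !)) ⟨
  2ℚ * inv (fromℕ (suc c !)) ∎
  where
  open ≡-Reasoning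
  K = fromℕ c
  d = z 0 - z c
  1+K≢0 : 1ℚ + K ≢ 0ℚ
  1+K≢0 e = fromℕ-suc≢0 c (trans (fromℕ-suc c) e)
  2d : 2ℚ * d ≡ (1ℚ + K) * - K
  2d = trans (2*[z-z] 0 c) (trans (cong (λ o → - ((K - o) * (1ℚ + K + o))) fromℕ-0) (lem K))
    where
    lem : ∀ K → - ((K - 0ℚ) * (1ℚ + K + 0ℚ)) ≡ (1ℚ + K) * - K
    lem = solve-∀ ring
  eq : 2ℚ * inv (1ℚ + K) ≡ - K * inv d
  eq = trans (cross {x₁ = 2ℚ} {x₂ = 1ℚ} {y₂ = 1ℚ} {n = - K} 1+K≢0 (λ ()) (z-≢ 0<c)
               (trans (cong (_* d) (*-identityʳ 2ℚ)) (trans 2d (lem (1ℚ + K) (- K)))))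
             (trans (cong (_* (- K * inv d)) (*-inv {1ℚ} (λ ()))) (*-identityˡ (- K * inv d)))
    where
    lem : ∀ x y → x * y ≡ 1ℚ * y * x
    lem = solve-∀ ring
rowInv-suc {c} {a ∷ as} 0<c (a<c ∷ as<c) (cons 0<a as<a dec) = begin
  - K * E as (dd a g) * (rowInv c as * ρ)
    ≡⟨ cong (λ e → - K * e * (rowInv c as * ρ)) (trans (E-below 0<a as<a step) (E-scale as p g)) ⟩
  - K * (p * E as g) * (rowInv c as * ρ)  ≡⟨ lem₁ (- K) p (E as g) (rowInv c as) ρ ⟩
  - K * E as g * rowInv c as * (ρ * p)
    ≡⟨ cong₂ _*_ (rowInv-suc 0<c as<c dec) (sym (factor-suc a<c)) ⟩
  2ℚ * rowInv (suc c) as * ρ′             ≡⟨ *-assoc 2ℚ (rowInv (suc c) as) ρ′ ⟩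
  2ℚ * (rowInv (suc c) as * ρ′)           ∎
  where
  open ≡-Reasoning
  K = fromℕ c
  g : ℕ → ℚ
  g b = inv (z b - z c)
  p = (t a - z c) * inv (z a - z c)
  ρ = (K - fromℕ a) * inv (K + fromℕ a)
  ρ′ = (fromℕ (suc c) - fromℕ a) * inv (fromℕ (suc c) + fromℕ a)
  lem₁ : ∀ K p e r ρ → K * (p * e) * (r * ρ) ≡ K * e * r * (ρ * p)
  lem₁ = solve-∀ ring
  lem₂ : ∀ zb za zc ta i j k → ((zb - ta) * i - (za - ta) * j) * k
    ≡ (((zb - zc) * i) - ((za - zc) * j)) * k
      + (ta - zc) * (j * 1ℚ - i * 1ℚ) * k
  lem₂ = solve-∀ ring
  lem₃ : ∀ x y u i j k → (1ℚ - 1ℚ) * k + u * (j * (x * i) - i * (y * j)) * k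
    ≡ (u * j) * i * ((x - y) * k)
  lem₃ = solve-∀ ring
  lem₄ : ∀ x y zc → (x - zc) - (y - zc) ≡ x - y
  lem₄ = solve-∀ ring
  -- Splitting z - t a into (z - z c) + (z c - t a) makes the constant parts cancel. The units
  -- multiplying j and i are then expanded to x i and y j, which turns 1 / y - 1 / x into (x - y) /
  -- (x y), and x - y cancels against k.
  step : ∀ b → b ℕ.< a → dd a g b ≡ p * g b
  step b b<a = begin
    ((z b - t a) * i - (z a - t a) * j) * k ≡⟨ lem₂ (z b) (z a) (z c) (t a) i j k ⟩
    ((x * i) - (y * j)) * k + (t a - z c) * (j * 1ℚ - i * 1ℚ) * k
      ≡⟨ cong₂ (λ u v → (u - v) * k + (t a - z c) * (j * 1ℚ - i * 1ℚ) * k) xi yj ⟩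
    (1ℚ - 1ℚ) * k + (t a - z c) * (j * 1ℚ - i * 1ℚ) * k
      ≡⟨ cong₂ (λ u v → (1ℚ - 1ℚ) * k + (t a - z c) * (j * u - i * v) * k) (sym xi) (sym yj) ⟩
    (1ℚ - 1ℚ) * k + (t a - z c) * (j * (x * i) - i * (y * j)) * k
      ≡⟨ lem₃ x y (t a - z c) i j k ⟩
    p * g b * ((x - y) * k) ≡⟨ cong (λ w → p * g b * (w * k)) (lem₄ (z b) (z a) (z c)) ⟩
    p * g b * ((z b - z a) * k) ≡⟨ cong (p * g b *_) (*-inv (z-≢ b<a)) ⟩
    p * g b * 1ℚ ≡⟨ *-identityʳ (p * g b) ⟩
    p * g b ∎
    where
    i = inv (z b - z c)
    j = inv (z a - z c)
    k = inv (z b - z a)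
    x = z b - z c
    y = z a - z c
    xi : x * i ≡ 1ℚ
    xi = *-inv (z-≢ (ℕₚ.<-trans b<a a<c))
    yj : y * j ≡ 1ℚ
    yj = *-inv (z-≢ a<c)

-- Stated for every F so that the induction can change F. Enlarging a row below the first multiplies
-- F b by (z b - t a) / (z b - z a); enlarging the first row contributes -a F(a) / (z b - z a) under
-- `E as`. Because a = z a - t a, the two add up to `dd a F`.
addSum-hookInv : ∀ {as} → Decreasing as → ∀ F → addSum (λ b bs → F b * hookInv bs) as
  ≡ hookInv as * E as F
addSum-hookInv [] F = trans (cong (λ x → F 0 * (x * 1ℚ)) unit) (lem (F 0))
  where
  unit : inv (fromℕ (1 !)) ≡ 1ℚ
  unit = trans (sym (*-identityˡ _))
    (trans (cong (_* inv (fromℕ 1)) (sym fromℕ-1)) (*-inv (fromℕ-suc≢0 0)))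
  lem : ∀ x → x * (1ℚ * 1ℚ) ≡ 1ℚ * x
  lem = solve-∀ ring
addSum-hookInv {a ∷ as} (cons 0<a as<a dec) F = begin
  2ℚ * (F a * (rowInv (suc a) as * h)) + addSum (λ b bs → F b * (rowInv a bs * hookInv bs)) as
    ≡⟨ cong₂ _+_ (lem₁ 2ℚ (F a) (rowInv (suc a) as) h)
         (addSum-cong as λ {b} {bs} inc → trans
           (cong (λ x → F b * (x * hookInv bs)) (rowInv-inc 0<a as<a inc))
           (lem₂ (F b) r (z b - t a) (i b) (hookInv bs))) ⟩
  2ℚ * rowInv (suc a) as * (F a * h) + addSum (λ b bs → r * ((z b - t a) * F b * i b * hookInv bs)) as
    ≡⟨ cong₂ (λ x y → x * (F a * h) + y) (sym (rowInv-suc 0<a as<a dec))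
         (trans (addSum-scale r _ as)
           (cong (r *_) (addSum-hookInv dec (λ b → (z b - t a) * F b * i b)))) ⟩
  - A * E as i * r * (F a * h) + r * (h * E as (λ b → (z b - t a) * F b * i b))
    ≡⟨ lem₃ A (E as i) r (F a) h (E as (λ b → (z b - t a) * F b * i b)) ⟩
  r * h * ((- (A * F a)) * E as i + 1ℚ * E as (λ b → (z b - t a) * F b * i b))
    ≡⟨ cong (r * h *_) (E-linear as (- (A * F a)) 1ℚ i (λ b → (z b - t a) * F b * i b)) ⟨
  r * h * E as (λ b → (- (A * F a)) * i b + 1ℚ * ((z b - t a) * F b * i b))
    ≡⟨ cong (r * h *_) (E-ext as λ b → trans (lem₄ A (F a) (i b) ((z b - t a) * F b))
      (cong (λ w → ((z b - t a) * F b - w * F a) * i b) A≡)) ⟩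
  r * h * E as (dd a F) ∎
  where
  open ≡-Reasoning
  A = fromℕ a
  r = rowInv a as
  h = hookInv as
  i : ℕ → ℚ
  i b = inv (z b - z a)
  A≡ : A ≡ z a - t a
  A≡ = trans (lem A (t a)) (cong (_- t a) (sym (z-t a)))
    where
    lem : ∀ x y → x ≡ (x + y) - y
    lem = solve-∀ ring
  lem₁ : ∀ k f r h → k * (f * (r * h)) ≡ k * r * (f * h)
  lem₁ = solve-∀ ring
  lem₂ : ∀ f r n i h → f * (r * (n * i) * h) ≡ r * (n * f * i * h)
  lem₂ = solve-∀ ring
  lem₃ : ∀ A e r f h e′ → - A * e * r * (f * h) + r * (h * e′) ≡ r * h * ((- (A * f)) * e + 1ℚ * e′)
  lem₃ = solve-∀ ring
  lem₄ : ∀ A f i x → (- (A * f)) * i + 1ℚ * (x * i) ≡ (x - A * f) * i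
  lem₄ = solve-∀ ring

-- Hook lengths

count-all : ∀ {A : Set} {P : A → Set} (P? : Decidable P) (f : ℕ → A) n → (∀ i → P (f i)) →
  length (filter P? (applyUpTo f n)) ≡ n
count-all P? f n h = trans (cong length (filter-all P? (Allₚ.applyUpTo⁺₂ f n h))) (length-applyUpTo f n)

count-> : ∀ {A : Set} {P : A → Set} (P? : Decidable P) (f : ℕ → A) n c → (∀ i → P (f i) ⇔ c ℕ.< i) →
  length (filter P? (applyUpTo f n)) ≡ n ∸ suc c
count-> P? f zero    c h = refl
count-> P? f (suc n) c h =
  trans (cong length (filter-reject P? (λ p → contradiction (Equivalence.to (h 0) p) λ ()))) (rest c h)
  where
  rest : ∀ c → (∀ i → _ ⇔ c ℕ.< i) → length (filter P? (applyUpTo (f ∘ suc) n)) ≡ n ∸ c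
  rest zero    h = count-all P? (f ∘ suc) n (λ i → Equivalence.from (h (suc i)) (ℕ.s≤s ℕ.z≤n))
  rest (suc c) h =
    count-> P? (f ∘ suc) n c (λ i → mk⇔ (ℕₚ.≤-pred ∘ Equivalence.to (h (suc i))) (Equivalence.from (h
      (suc i)) ∘ ℕ.s≤s))

𝟙 : ∀ {P : Set} → Dec P → ℕ
𝟙 P? = if does P? then 1 else 0

count-≡ : ∀ {A : Set} {P : A → Set} (P? : Decidable P) (f : ℕ → A) n c → (∀ i → P (f i) ⇔ c ≡ i) →
  length (filter P? (applyUpTo f n)) ≡ 𝟙 (c ℕₚ.<? n)
count-≡ P? f zero    c       h = refl
count-≡ P? f (suc n) zero    h =
  trans (cong length (filter-accept P? (Equivalence.from (h 0) refl)))
    (cong (suc ∘ length) (filter-none P? (Allₚ.applyUpTo⁺₂ (f ∘ suc) n (λ i p → contradiction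
      (Equivalence.to (h (suc i)) p) λ ()))))
count-≡ P? f (suc n) (suc c) h =
  trans (cong length (filter-reject P? (λ p → contradiction (Equivalence.to (h 0) p) λ ())))
    (count-≡ P? (f ∘ suc) n c (λ i → mk⇔ (ℕₚ.suc-injective ∘ Equivalence.to (h (suc i)))
      (Equivalence.from (h (suc i)) ∘ cong suc)))

-- The leg length of box number t (counted from 0) of a row with the rows as below it.
legs : List ℕ → ℕ → ℕ
legs []       t       = 0
legs (b ∷ bs) zero    = 0
legs (b ∷ bs) (suc t) = 𝟙 (t ℕₚ.<? b) ℕ.+ legs bs t

boxesFrom-All : ∀ {P : Box → Set} s as → (∀ i j → s ℕ.≤ i → i ℕ.< j → P (i , j)) → All P
  (boxesFrom s as)
boxesFrom-All s []       h = []
boxesFrom-All s (a ∷ as) h = Allₚ.++⁺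
  (Allₚ.map⁺ (All.universal (λ t → h s (s ℕ.+ suc t) ℕₚ.≤-refl (ℕₚ.m<m+n s (ℕ.s≤s ℕ.z≤n))) (upTo a)))
  (boxesFrom-All (suc s) as (λ i j s<i → h i j (ℕₚ.<⇒≤ s<i)))

boxesFrom-All-< : ∀ {P : Box → Set} s as → (∀ i j → i ℕ.< s ℕ.+ length as → P (i , j)) → All P
  (boxesFrom s as)
boxesFrom-All-< s []       h = []
boxesFrom-All-< s (a ∷ as) h = Allₚ.++⁺
  (Allₚ.map⁺ (All.universal (λ t → h s (s ℕ.+ suc t) (ℕₚ.m<m+n s (ℕ.s≤s ℕ.z≤n))) (upTo a)))
  (boxesFrom-All-< (suc s) as (λ i j lt → h i j (subst (i ℕ.<_) (sym (ℕₚ.+-suc s (length as))) lt)))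

boxesFrom-++ : ∀ s as bs → boxesFrom s (as ++ bs) ≡ boxesFrom s as ++ boxesFrom (s ℕ.+ length as) bs
boxesFrom-++ s []       bs = cong (λ n → boxesFrom n bs) (sym (ℕₚ.+-identityʳ s))
boxesFrom-++ s (a ∷ as) bs =
  trans (cong (map (λ t → s , s ℕ.+ suc t) (upTo a) ++_) (trans (boxesFrom-++ (suc s) as bs)
          (cong (λ n → boxesFrom (suc s) as ++ boxesFrom n bs) (sym (ℕₚ.+-suc s (length as))))))
        (sym (++-assoc (map (λ t → s , s ℕ.+ suc t) (upTo a)) (boxesFrom (suc s) as) (boxesFrom
          (s ℕ.+ suc (length as)) bs)))

part-++ : ∀ as bs k → part (as ++ bs) (length as ℕ.+ suc k) ≡ part bs (suc k)
part-++ []       bs k = refl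
part-++ (a ∷ as) bs k = trans (cong (part (a ∷ as ++ bs) ∘ suc) (ℕₚ.+-suc (length as) k))
  (trans (cong (part (as ++ bs)) (sym (ℕₚ.+-suc (length as) k))) (part-++ as bs k))

length-filter-++ : ∀ {A : Set} {P : A → Set} (P? : Decidable P) xs ys →
  length (filter P? (xs ++ ys)) ≡ length (filter P? xs) ℕ.+ length (filter P? ys)
length-filter-++ P? xs ys = trans (cong length (filter-++ P? xs ys)) (length-++ (filter P? xs))

length-filter-none : ∀ {A : Set} {P : A → Set} (P? : Decidable P) {xs} → All (¬_ ∘ P) xs → length
  (filter P? xs) ≡ 0
length-filter-none P? none = cong length (filter-none P? none)

-- P is constrained only on boxes in rows beyond n, so one and the same filter can be followed
-- through the recursion while rows are dropped. Each row starts one column further right than the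
-- row above it, which is why the box number falls by one per row.
legs-count : ∀ {P : Box → Set} (P? : Decidable P) n as t → (∀ i j → n ℕ.< i → P (i , j) ⇔ j
  ≡ n ℕ.+ suc t) →
  length (filter P? (boxesFrom (suc n) as)) ≡ legs as t
legs-count P? n []       t h = refl
legs-count {P} P? n (b ∷ bs) t h =
  trans (length-filter-++ P? (map row (upTo b)) (boxesFrom (suc (suc n)) bs)) (go t h)
  where
  row : ℕ → Box
  row i = suc n , suc n ℕ.+ suc i
  go : ∀ t → (∀ i j → n ℕ.< i → P (i , j) ⇔ j ≡ n ℕ.+ suc t) →
    length (filter P? (map row (upTo b))) ℕ.+ length (filter P? (boxesFrom (suc (suc n)) bs))
      ≡ legs (b ∷ bs) t
  go zero h = cong₂ ℕ._+_
    (length-filter-none P? (Allₚ.map⁺ (All.universal (λ i p → too-far (suc n) _ ℕₚ.≤-refl (ℕₚ.m<m+n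
      (suc n) (ℕ.s≤s ℕ.z≤n)) p) (upTo b))))
    (length-filter-none P? (boxesFrom-All (suc (suc n)) bs (λ i j 1+n<i → too-far i j (ℕₚ.<⇒≤ 1+n<i))))
    where
    too-far : ∀ i j → n ℕ.< i → i ℕ.< j → ¬ P (i , j)
    too-far i j n<i i<j p = ℕₚ.<-irrefl refl
      (ℕₚ.<-≤-trans (ℕₚ.≤-<-trans n<i i<j) (ℕₚ.≤-reflexive
        (trans (Equivalence.to (h i j n<i) p) (ℕₚ.+-comm n 1))))
  go (suc t) h = cong₂ ℕ._+_
    (trans (cong (length ∘ filter P?) (map-upTo row b))
      (count-≡ P? row b t (λ i → mk⇔
        (λ p → sym (ℕₚ.suc-injective (ℕₚ.suc-injective (ℕₚ.+-cancelˡ-≡ n _ _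
                 (trans (ℕₚ.+-suc n (suc i)) (Equivalence.to (h _ _ ℕₚ.≤-refl) p))))))
        (λ { refl → Equivalence.from (h _ _ ℕₚ.≤-refl) (sym (ℕₚ.+-suc n (suc i))) }))))
    (legs-count P? (suc n) bs t (λ i j n<i → subst (λ m → P (i , j) ⇔ j
      ≡ m) (ℕₚ.+-suc n (suc t)) (h i j (ℕₚ.<⇒≤ n<i))))

-- The column of box t of row n is n + t + 1; read as an index of λ it points to entry t + 1 of the
-- rows below row n. So the summand λ_j, and with it the whole hook length, depends only on the row
-- and the rows below it.
hookRow : ℕ → List ℕ → ℕ → ℕ
hookRow a as t = suc (a ∸ suc t ℕ.+ legs as t ℕ.+ part as (suc t))

hook-row : ∀ lam pre a as t → parts lam ≡ pre ++ a ∷ as →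
  hook lam (suc (length pre) , suc (length pre) ℕ.+ suc t) ≡ hookRow a as t
hook-row (mkStrict _ _) pre a as t refl = cong suc (cong₂ ℕ._+_ (cong₂ ℕ._+_ arm≡ leg≡)
    (trans (cong (part (pre ++ a ∷ as)) (sym (ℕₚ.+-suc n (suc t)))) (part-++ pre (a ∷ as) (suc t))))
  where
  n = length pre
  row : ℕ → Box
  row i = suc n , suc n ℕ.+ suc i
  arm? = λ (b : Box) → (proj₁ b ℕₚ.≟ suc n) ×-dec (proj₂ b ℕₚ.>? (suc n ℕ.+ suc t))
  leg? = λ (b : Box) → (proj₁ b ℕₚ.>? suc n) ×-dec (proj₂ b ℕₚ.≟ (suc n ℕ.+ suc t))
  split : ∀ {P : Box → Set} (P? : Decidable P) → length (filter P? (boxesFrom 1 (pre ++ a ∷ as)))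
    ≡ length (filter P? (boxesFrom 1 pre)) ℕ.+ (length (filter P? (map row (upTo a))) ℕ.+ length
      (filter P? (boxesFrom (suc (suc n)) as)))
  split P? = trans (cong (length ∘ filter P?) (boxesFrom-++ 1 pre (a ∷ as)))
    (trans (length-filter-++ P? (boxesFrom 1 pre) (boxesFrom (suc n) (a ∷ as)))
      (cong (length (filter P? (boxesFrom 1 pre)) ℕ.+_) (length-filter-++ P? (map row (upTo a))
        (boxesFrom (suc (suc n)) as))))
  arm≡ : length (filter arm? (boxesFrom 1 (pre ++ a ∷ as))) ≡ a ∸ suc t
  arm≡ = trans (split arm?) (trans (cong₂ ℕ._+_
    (length-filter-none arm? (boxesFrom-All-< 1 pre (λ i j lt (eq , _) → ℕₚ.<⇒≢ lt eq)))
    (cong₂ ℕ._+_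
      (trans (cong (length ∘ filter arm?) (map-upTo row a)) (count-> arm? row a t (λ i → mk⇔
        (λ (_ , lt) → ℕₚ.≤-pred (ℕₚ.+-cancelˡ-< (suc n) _ _ lt))
        (λ lt → refl , ℕₚ.+-monoʳ-< (suc n) (ℕ.s≤s lt)))))
      (length-filter-none arm? (boxesFrom-All (suc (suc n)) as (λ i j lt _ (eq , _) → ℕₚ.<⇒≢ lt
        (sym eq))))))
    (ℕₚ.+-identityʳ (a ∸ suc t)))
  leg≡ : length (filter leg? (boxesFrom 1 (pre ++ a ∷ as))) ≡ legs as t
  leg≡ = trans (split leg?) (cong₂ ℕ._+_
    (length-filter-none leg? (boxesFrom-All-< 1 pre (λ i j lt (gt , _) → ℕₚ.<-asym lt gt)))
    (cong₂ ℕ._+_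
      (length-filter-none leg? (Allₚ.map⁺ (All.universal (λ i (gt , _) → ℕₚ.<-irrefl refl gt)
        (upTo a))))
      (legs-count leg? (suc n) as t (λ i j lt → mk⇔ proj₂ (lt ,_)))))

rowHooks : ℕ → List ℕ → ℕ
rowHooks a as = product (applyUpTo (hookRow a as) a)

allHooks : List ℕ → ℕ
allHooks []       = 1
allHooks (a ∷ as) = rowHooks a as ℕ.* allHooks as

H≡allHooks : ∀ lam → H lam ≡ allHooks (parts lam)
H≡allHooks lam = go [] (parts lam) refl
  where
  go : ∀ pre as → parts lam ≡ pre ++ as → product (map (hook lam) (boxesFrom (suc (length pre)) as))
    ≡ allHooks as
  go pre []       eq = refl
  go pre (a ∷ as) eq =
    trans (cong product (map-++ (hook lam) (map row (upTo a)) (boxesFrom (suc (suc n)) as)))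
    (trans (product-++ (map (hook lam) (map row (upTo a))) (map (hook lam) (boxesFrom (suc
      (suc n)) as)))
      (cong₂ ℕ._*_
        (cong product (trans (sym (map-∘ (upTo a)))
          (trans (map-cong (λ t → hook-row lam pre a as t eq) (upTo a))
          (map-upTo (hookRow a as) a))))
        (subst (λ m → product (map (hook lam) (boxesFrom (suc m) as)) ≡ allHooks as)
          (trans (length-++ pre) (ℕₚ.+-comm n 1))
          (go (pre ++ a ∷ []) as (trans eq (sym (++-assoc pre (a ∷ []) as)))))))
    where
    n = length pre
    row : ℕ → Box
    row i = suc n , suc n ℕ.+ suc i

-- Positive parts that decrease strictly below b number fewer than b, and the one-column shift per
-- row is compensated by the decrease. So from box b on there is neither a box underneath nor a part
-- λ_j to add.
legs-beyond : ∀ {b bs} → All (ℕ._< b) bs → Decreasing bs → ∀ {t} → b ℕ.≤ t → legs bs t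
  ≡ 0 × part bs (suc t) ≡ 0
legs-beyond []        []                {t}     b≤t = refl , refl
legs-beyond (c<b ∷ _) (cons 0<c cs<c dec) {zero}  b≤t = contradiction (ℕₚ.<-≤-trans c<b b≤t) λ ()
legs-beyond {bs = c ∷ _} (c<b ∷ _) (cons 0<c cs<c dec) {suc t} b≤t
  with c≤t ← ℕₚ.≤-pred (ℕₚ.<-≤-trans c<b b≤t)
  with l , p ← legs-beyond cs<c dec c≤t = cong₂ ℕ._+_ outside l , p
  where
  outside : 𝟙 (t ℕₚ.<? c) ≡ 0
  outside = cong (λ d → if d then 1 else 0) (dec-false (t ℕₚ.<? c) (ℕₚ.≤⇒≯ c≤t))

product-applyUpTo-cong : ∀ {f g : ℕ → ℕ} n → (∀ i → i ℕ.< n → f i ≡ g i) → product (applyUpTo f n)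
  ≡ product (applyUpTo g n)
product-applyUpTo-cong zero    h = refl
product-applyUpTo-cong (suc n) h =
  cong₂ ℕ._*_ (h 0 (ℕ.s≤s ℕ.z≤n)) (product-applyUpTo-cong n (λ i i<n → h (suc i) (ℕ.s≤s i<n)))

product-applyUpTo-+ : ∀ (f : ℕ → ℕ) m n → product (applyUpTo f (m ℕ.+ n))
  ≡ product (applyUpTo f m) ℕ.* product (applyUpTo (λ i → f (m ℕ.+ i)) n)
product-applyUpTo-+ f zero    n = sym (ℕₚ.+-identityʳ _)
product-applyUpTo-+ f (suc m) n = trans (cong (f 0 ℕ.*_) (product-applyUpTo-+ (f ∘ suc) m n))
  (sym (ℕₚ.*-assoc (f 0) (product (applyUpTo (f ∘ suc) m)) (product (applyUpTo (λ i → f (suc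
    (m ℕ.+ i))) n))))

product-countdown : ∀ n → product (applyUpTo (λ i → suc (n ∸ suc i)) n) ≡ n !
product-countdown zero    = refl
product-countdown (suc n) = cong (suc n ℕ.*_) (product-countdown n)

rowHooks-[] : ∀ a → rowHooks a [] ≡ a !
rowHooks-[] a =
  trans (product-applyUpTo-cong a (λ i _ → cong suc
    (trans (ℕₚ.+-identityʳ _) (ℕₚ.+-identityʳ _)))) (product-countdown a)

-- Inserting the row b puts a + b in front, keeps the next b hooks of the row a and replaces the
-- remaining ones, which are m + 1, …, 1, by m, …, 1.
rowHooks-∷ : ∀ {b bs} m → All (ℕ._< b) bs → Decreasing bs →
  rowHooks (suc (b ℕ.+ m)) (b ∷ bs) ℕ.* suc m ≡ (suc (b ℕ.+ m) ℕ.+ b) ℕ.* rowHooks (suc (b ℕ.+ m)) bs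
rowHooks-∷ {b} {bs} m bs<b dec = begin
  hookRow a (b ∷ bs) 0 ℕ.* product (applyUpTo (hookRow a (b ∷ bs) ∘ suc) (b ℕ.+ m)) ℕ.* suc m
    ≡⟨ cong₂ (λ x y → x ℕ.* y ℕ.* suc m) (cong (λ x → suc (x ℕ.+ b)) (ℕₚ.+-identityʳ (b ℕ.+ m)))
         (trans (product-applyUpTo-+ (hookRow a (b ∷ bs) ∘ suc) b m)
           (cong₂ ℕ._*_ (product-applyUpTo-cong b low) high)) ⟩
  (a ℕ.+ b) ℕ.* (L ℕ.* m !) ℕ.* suc m
    ≡⟨ ℕₚ.*-assoc (a ℕ.+ b) (L ℕ.* m !) (suc m) ⟩
  (a ℕ.+ b) ℕ.* (L ℕ.* m ! ℕ.* suc m)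
    ≡⟨ cong ((a ℕ.+ b) ℕ.*_)
      (trans (ℕₚ.*-assoc L (m !) (suc m)) (cong (L ℕ.*_) (ℕₚ.*-comm (m !) (suc m)))) ⟩
  (a ℕ.+ b) ℕ.* (L ℕ.* (suc m) !)
    ≡⟨ cong (λ x → (a ℕ.+ b) ℕ.* (L ℕ.* x)) high′ ⟨
  (a ℕ.+ b) ℕ.* (L ℕ.* product (applyUpTo (λ i → hookRow a bs (b ℕ.+ i)) (suc m)))
    ≡⟨ cong ((a ℕ.+ b) ℕ.*_) (product-applyUpTo-+ (hookRow a bs) b (suc m)) ⟨
  (a ℕ.+ b) ℕ.* product (applyUpTo (hookRow a bs) (b ℕ.+ suc m))
    ≡⟨ cong (λ k → (a ℕ.+ b) ℕ.* product (applyUpTo (hookRow a bs) k)) (ℕₚ.+-suc b m) ⟩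
  (a ℕ.+ b) ℕ.* rowHooks a bs ∎
  where
  open ≡-Reasoning
  a = suc (b ℕ.+ m)
  L = product (applyUpTo (hookRow a bs) b)
  inside : ∀ {t} → t ℕ.< b → 𝟙 (t ℕₚ.<? b) ≡ 1
  inside {t} t<b = cong (λ d → if d then 1 else 0) (dec-true (t ℕₚ.<? b) t<b)
  outside : ∀ {t} → b ℕ.≤ t → 𝟙 (t ℕₚ.<? b) ≡ 0
  outside {t} b≤t = cong (λ d → if d then 1 else 0) (dec-false (t ℕₚ.<? b) (ℕₚ.≤⇒≯ b≤t))
  low : ∀ t → t ℕ.< b → hookRow a (b ∷ bs) (suc t) ≡ hookRow a bs t
  low t t<b = cong (λ x → suc (x ℕ.+ part bs (suc t))) (begin
    (b ℕ.+ m) ∸ suc t ℕ.+ (𝟙 (t ℕₚ.<? b) ℕ.+ legs bs t)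
      ≡⟨ cong (λ x → (b ℕ.+ m) ∸ suc t ℕ.+ (x ℕ.+ legs bs t)) (inside t<b) ⟩
    (b ℕ.+ m) ∸ suc t ℕ.+ suc (legs bs t)              ≡⟨ ℕₚ.+-suc ((b ℕ.+ m) ∸ suc t) (legs bs t) ⟩
    suc ((b ℕ.+ m) ∸ suc t) ℕ.+ legs bs t
      ≡⟨ cong (ℕ._+ legs bs t) (ℕₚ.+-∸-assoc 1 (ℕₚ.≤-trans t<b (ℕₚ.m≤m+n b m))) ⟨
    (b ℕ.+ m) ∸ t ℕ.+ legs bs t                        ∎)
  high : product (applyUpTo (λ i → hookRow a (b ∷ bs) (suc (b ℕ.+ i))) m) ≡ m !
  high = trans (product-applyUpTo-cong m step) (product-countdown m)
    where
    step : ∀ i → i ℕ.< m → hookRow a (b ∷ bs) (suc (b ℕ.+ i)) ≡ suc (m ∸ suc i)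
    step i _ with l , p ← legs-beyond bs<b dec (ℕₚ.m≤m+n b i) = cong suc (begin
      (b ℕ.+ m) ∸ suc (b ℕ.+ i) ℕ.+ (𝟙 (b ℕ.+ i ℕₚ.<? b) ℕ.+ legs bs (b ℕ.+ i)) ℕ.+ part bs (suc
        (b ℕ.+ i))
        ≡⟨ cong₂ (λ x y → (b ℕ.+ m) ∸ suc (b ℕ.+ i) ℕ.+ x ℕ.+ y)
          (cong₂ ℕ._+_ (outside (ℕₚ.m≤m+n b i)) l) p ⟩
      (b ℕ.+ m) ∸ suc (b ℕ.+ i) ℕ.+ 0 ℕ.+ 0 ≡⟨ trans (ℕₚ.+-identityʳ _) (ℕₚ.+-identityʳ _) ⟩
      (b ℕ.+ m) ∸ suc (b ℕ.+ i)             ≡⟨ cong ((b ℕ.+ m) ∸_) (ℕₚ.+-suc b i) ⟨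
      (b ℕ.+ m) ∸ (b ℕ.+ suc i)             ≡⟨ ℕₚ.[m+n]∸[m+o]≡n∸o b m (suc i) ⟩
      m ∸ suc i                             ∎)
  high′ : product (applyUpTo (λ i → hookRow a bs (b ℕ.+ i)) (suc m)) ≡ (suc m) !
  high′ = trans (product-applyUpTo-cong (suc m) step) (product-countdown (suc m))
    where
    step : ∀ i → i ℕ.< suc m → hookRow a bs (b ℕ.+ i) ≡ suc (m ∸ i)
    step i _ with l , p ← legs-beyond bs<b dec (ℕₚ.m≤m+n b i) = cong suc (trans
      (cong₂ (λ x y → (b ℕ.+ m) ∸ (b ℕ.+ i) ℕ.+ x ℕ.+ y) l p)
      (trans (ℕₚ.+-identityʳ _) (trans (ℕₚ.+-identityʳ _) (ℕₚ.[m+n]∸[m+o]≡n∸o b m i))))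

rowHooks-inv : ∀ {a as} → 0 ℕ.< a → All (ℕ._< a) as → Decreasing as → fromℕ
  (rowHooks a as) * rowInv a as ≡ 1ℚ
rowHooks-inv {a} 0<a [] [] = trans (cong (λ n → fromℕ n * inv (fromℕ (a !))) (rowHooks-[] a))
  (*-inv (fromℕ-≢0 (ℕ.>-nonZero⁻¹ (a !) {{a ℕₚ.!≢0}})))
-- The witness m is a - b - 1, so the factor `suc m` of `rowHooks-∷` is the numerator a - b of
-- `rowInv`.
rowHooks-inv {a} {b ∷ bs} 0<a (b<a ∷ bs<a) (cons 0<b bs<b dec) with m , refl ← ℕₚ.m≤n⇒∃[o]m+o≡n b<a =
  begin
  fromℕ (rowHooks a (b ∷ bs)) * (rowInv a bs * ((A - B) * inv (A + B)))
    ≡⟨ cong (λ x → fromℕ (rowHooks a (b ∷ bs)) * (rowInv a bs * (x * inv (A + B)))) A-B ⟩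
  fromℕ (rowHooks a (b ∷ bs)) * (rowInv a bs * (fromℕ (suc m) * inv (A + B)))
    ≡⟨ lem₁ (fromℕ (rowHooks a (b ∷ bs))) (rowInv a bs) (fromℕ (suc m)) (inv (A + B)) ⟩
  fromℕ (rowHooks a (b ∷ bs)) * fromℕ (suc m) * (rowInv a bs * inv (A + B))
    ≡⟨ cong (_* (rowInv a bs * inv (A + B))) (trans (sym (fromℕ-* (rowHooks a (b ∷ bs)) (suc m)))
         (trans (cong fromℕ (rowHooks-∷ m bs<b dec))
           (trans (fromℕ-* (a ℕ.+ b) (rowHooks a bs))
             (cong (_* fromℕ (rowHooks a bs)) (fromℕ-+ a b))))) ⟩
  (A + B) * fromℕ (rowHooks a bs) * (rowInv a bs * inv (A + B))
    ≡⟨ lem₂ (A + B) (fromℕ (rowHooks a bs)) (rowInv a bs) (inv (A + B)) ⟩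
  ((A + B) * inv (A + B)) * (fromℕ (rowHooks a bs) * rowInv a bs)
    ≡⟨ cong₂ _*_ (*-inv (A+B≢0 b 0<a)) (rowHooks-inv 0<a bs<a dec) ⟩
  1ℚ * 1ℚ ≡⟨ *-identityˡ 1ℚ ⟩
  1ℚ ∎
  where
  open ≡-Reasoning
  A = fromℕ a
  B = fromℕ b
  A-B : A - B ≡ fromℕ (suc m)
  A-B = trans (cong (_- B)
    (trans (cong fromℕ (sym (ℕₚ.+-suc b m))) (fromℕ-+ b (suc m)))) (lem B (fromℕ (suc m)))
    where
    lem : ∀ x y → (x + y) - x ≡ y
    lem = solve-∀ ring
  lem₁ : ∀ h r d i → h * (r * (d * i)) ≡ h * d * (r * i)
  lem₁ = solve-∀ ring
  lem₂ : ∀ s h r i → s * h * (r * i) ≡ (s * i) * (h * r)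
  lem₂ = solve-∀ ring

allHooks-inv : ∀ {as} → Decreasing as → fromℕ (allHooks as) * hookInv as ≡ 1ℚ
allHooks-inv [] = trans (*-identityʳ (fromℕ 1)) fromℕ-1
allHooks-inv {a ∷ as} (cons 0<a as<a dec) =
  trans (cong (_* (rowInv a as * hookInv as)) (fromℕ-* (rowHooks a as) (allHooks as)))
  (trans (lem (fromℕ (rowHooks a as)) (fromℕ (allHooks as)) (rowInv a as) (hookInv as))
    (trans (cong₂ _*_ (rowHooks-inv 0<a as<a dec) (allHooks-inv dec)) (*-identityˡ 1ℚ)))
  where
  lem : ∀ x y u v → x * y * (u * v) ≡ (x * u) * (y * v)
  lem = solve-∀ ring

decreasing : ∀ {as} → IsStrict as → Decreasing as
decreasing {[]}     _ = []
decreasing {a ∷ as} (l , 0<a ∷ pos) with a>as ∷ _ ← Linkedₚ.Linked⇒AllPairs (λ p q → ℕₚ.<-trans q p) l =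
  cons 0<a a>as (decreasing (Linked.tail l , pos))

/H-hookInv : ∀ i lam → i /H lam ≡ ι i * hookInv (parts lam)
/H-hookInv i lam = begin
  x                                              ≡⟨ *-identityʳ x ⟨
  x * 1ℚ
    ≡⟨ cong (x *_) (allHooks-inv (decreasing (isStrict lam))) ⟨
  x * (fromℕ (allHooks (parts lam)) * h)         ≡⟨ *-assoc x (fromℕ (allHooks (parts lam))) h ⟨
  x * fromℕ (allHooks (parts lam)) * h           ≡⟨ cong (λ n → x * fromℕ n * h) (H≡allHooks lam) ⟨
  x * fromℕ (H lam) * h                          ≡⟨ cong (_* h) (/-fromℕ i (H lam) {{H≢0 lam}}) ⟩
  ι i * h                                        ∎
  where
  open ≡-Reasoning
  x = i /H lam
  h = hookInv (parts lam)

-- Outer corners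

strict : ∀ {as} → Decreasing as → IsStrict as
strict []                      = [] , []
strict (cons 0<a [] [])        = [-] , 0<a ∷ []
strict (cons 0<a (b<a ∷ _) dec) with l , pos ← strict dec = b<a ∷ l , 0<a ∷ pos

strict-∷ : ∀ {a as} → 0 ℕ.< a → All (ℕ._< a) as → IsStrict (a ∷ as) ⇔ IsStrict as
strict-∷ 0<a as<a =
  mk⇔ (λ { (l , _ ∷ pos) → Linked.tail l , pos }) (λ s → strict (cons 0<a as<a (decreasing s)))

removals-below : ∀ {c} s as → All (ℕ._< c) as → All (λ r → All (ℕ._< c) (proj₂ r)) (removalsFrom s as)
removals-below s [] [] = []
removals-below s (zero        ∷ as) (p ∷ ps) =
  (p ∷ ps) ∷ Allₚ.map⁺ (All.map (p ∷_) (removals-below (suc s) as ps))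
removals-below s (suc zero    ∷ as) (p ∷ ps) =
  ps ∷ Allₚ.map⁺ (All.map (p ∷_) (removals-below (suc s) as ps))
removals-below s (suc (suc a) ∷ as) (p ∷ ps) =
  (ℕₚ.<-trans (ℕₚ.n<1+n (suc a)) p ∷ ps) ∷ Allₚ.map⁺ (All.map (p ∷_) (removals-below (suc s) as ps))

filter-map : ∀ {A B : Set} {P : A → Set} (P? : Decidable P) (h : A → A) (f : A → B) {xs} →
  (∀ x → f (h x) ≡ f x) → All (λ x → P (h x) ⇔ P x) xs → map f (filter P? (map h xs))
    ≡ map f (filter P? xs)
filter-map P? h f fh [] = refl
filter-map P? h f {x ∷ xs} fh (P⇔ ∷ rest) with P? (h x) | P? x
... | yes _ | yes _ = cong₂ _∷_ (fh x) (filter-map P? h f fh rest)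
... | no _  | no _  = filter-map P? h f fh rest
... | yes p | no ¬p = contradiction (Equivalence.to P⇔ p) ¬p
... | no ¬p | yes p = contradiction (Equivalence.from P⇔ p) ¬p

corners : ℕ → List ℕ → List Box
corners s as = map proj₁ (filter (isStrict? ∘ proj₂) (removalsFrom s as))

-- Deleting a box from a lower row keeps all lower parts below a, so the row a never decides whether
-- the result is strict.
corners-tail : ∀ s {a as} → 0 ℕ.< a → All (ℕ._< a) as →
  map proj₁ (filter (isStrict? ∘ proj₂) (map (λ r → proj₁ r , a ∷ proj₂ r) (removalsFrom s as)))
    ≡ corners s as
corners-tail s {a} {as} 0<a as<a =
  filter-map (isStrict? ∘ proj₂) (λ r → proj₁ r , a ∷ proj₂ r) proj₁ (λ _ → refl)
  (All.map (strict-∷ 0<a) (removals-below s as as<a))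

corners-last : ∀ s {a} → 0 ℕ.< a → corners s (a ∷ []) ≡ (s , s ℕ.+ a) ∷ []
corners-last s {suc zero}    _ = refl
corners-last s {suc (suc a)} _ =
  cong (map proj₁) (filter-accept (isStrict? ∘ proj₂) {(s , s ℕ.+ suc (suc a)) , suc a ∷ []} {[]}
    ([-] , ℕ.s≤s ℕ.z≤n ∷ []))

corners-yes : ∀ s {a b bs} → suc b ℕ.< a → Decreasing (a ∷ b ∷ bs) →
  corners s (a ∷ b ∷ bs) ≡ (s , s ℕ.+ a) ∷ corners (suc s) (b ∷ bs)
corners-yes s {suc (suc a)} {b} {bs} (ℕ.s≤s b<a) (cons 0<a as<a dec@(cons _ bs<b _)) =
  trans (cong (map proj₁) (filter-accept (isStrict? ∘ proj₂) {(s , s ℕ.+ suc (suc a)) , suc a ∷ b ∷ bs}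
          {map (λ r → proj₁ r , suc (suc a) ∷ proj₂ r) (removalsFrom (suc s) (b ∷ bs))}
          (strict (cons (ℕ.s≤s ℕ.z≤n) (b<a ∷ All.map (λ lt → ℕₚ.<-trans lt b<a) bs<b) dec))))
        (cong (_ ∷_) (corners-tail (suc s) 0<a as<a))

corners-no : ∀ s {b bs} → Decreasing (suc b ∷ b ∷ bs) → corners s (suc b ∷ b ∷ bs)
  ≡ corners (suc s) (b ∷ bs)
corners-no s {suc b} {bs} (cons 0<a as<a dec) =
  trans (cong (map proj₁) (filter-reject (isStrict? ∘ proj₂) {(s , s ℕ.+ suc
    (suc b)) , suc b ∷ suc b ∷ bs}
          {map (λ r → proj₁ r , suc (suc b) ∷ proj₂ r) (removalsFrom (suc s) (suc b ∷ bs))}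
          (λ { (p ∷ _ , _) → ℕₚ.<-irrefl refl p })))
        (corners-tail (suc s) 0<a as<a)
corners-no s {zero} (cons _ _ (cons () _ _))

module _ (g : ℕ → ℕ) where

  -- Runs through x_m, ..., x_0, because the corners come here by increasing row: `p` is the row of
  -- the preceding corner, initially α_{m+1} = 0, and `n` stands for β_0.
  sumX : ℕ → List Box → ℕ → ℕ
  sumX n []             p = g (n ∸ p)
  sumX n ((α , β) ∷ cs) p = g (β ∸ p) ℕ.+ sumX n cs α

  sumY : List Box → ℕ
  sumY cs = sum (map (λ b → g (proj₂ b ∸ proj₁ b)) cs)

  -- p is the row of the previous corner, and the d rows between it and the row of a belong to the
  -- run a + d, …, a + 1, a of consecutive parts.
  corners-sum : ∀ p d as a → Decreasing (a ∷ as) → let s = suc (p ℕ.+ d) in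
    sumX (s ℕ.+ suc (length as)) (corners s (a ∷ as)) p ℕ.+ sum (map g (a ∷ as))
      ≡ sumY (corners s (a ∷ as)) ℕ.+ sum (map (g ∘ suc) as) ℕ.+ g (a ℕ.+ suc d) ℕ.+ g 1
  corners-sum p d [] a (cons 0<a _ _) rewrite corners-last (suc (p ℕ.+ d)) 0<a = begin
    g (s ℕ.+ a ∸ p) ℕ.+ g (s ℕ.+ 1 ∸ s) ℕ.+ (g a ℕ.+ 0)
      ≡⟨ cong₂ (λ x y → x ℕ.+ y ℕ.+ (g a ℕ.+ 0)) (cong g top) (cong g (ℕₚ.m+n∸m≡n s 1)) ⟩
    g (a ℕ.+ suc d) ℕ.+ g 1 ℕ.+ (g a ℕ.+ 0)
      ≡⟨ lem (g (a ℕ.+ suc d)) (g 1) (g a) ⟩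
    g a ℕ.+ 0 ℕ.+ 0 ℕ.+ g (a ℕ.+ suc d) ℕ.+ g 1
      ≡⟨ cong (λ x → g x ℕ.+ 0 ℕ.+ 0 ℕ.+ g (a ℕ.+ suc d) ℕ.+ g 1) (ℕₚ.m+n∸m≡n s a) ⟨
    g (s ℕ.+ a ∸ s) ℕ.+ 0 ℕ.+ 0 ℕ.+ g (a ℕ.+ suc d) ℕ.+ g 1 ∎
    where
    open ≡-Reasoning
    s = suc (p ℕ.+ d)
    top : s ℕ.+ a ∸ p ≡ a ℕ.+ suc d
    top = trans (cong (_∸ p) (lem p d a)) (ℕₚ.m+n∸m≡n p (a ℕ.+ suc d))
      where
      lem : ∀ p d a → suc (p ℕ.+ d) ℕ.+ a ≡ p ℕ.+ (a ℕ.+ suc d)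
      lem = ℕ-RingSolver.solve-∀
    lem : ∀ x y z → x ℕ.+ y ℕ.+ (z ℕ.+ 0) ≡ z ℕ.+ 0 ℕ.+ 0 ℕ.+ x ℕ.+ y
    lem = ℕ-RingSolver.solve-∀
  corners-sum p d (b ∷ bs) a dec@(cons 0<a (b<a ∷ _) dec′) with ℕₚ.m≤n⇒m<n∨m≡n b<a
  ... | inj₁ 1+b<a rewrite corners-yes (suc (p ℕ.+ d)) 1+b<a dec = begin
    g (s ℕ.+ a ∸ p) ℕ.+ sumX (s ℕ.+ suc (suc (length bs))) cs s ℕ.+ (g a ℕ.+ G)
      ≡⟨ cong₂ (λ x n → g x ℕ.+ sumX n cs s ℕ.+ (g a ℕ.+ G)) top (ℕₚ.+-suc s (suc (length bs))) ⟩
    g (a ℕ.+ suc d) ℕ.+ X ℕ.+ (g a ℕ.+ G)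
      ≡⟨ lem (g (a ℕ.+ suc d)) X (g a) G ⟩
    (X ℕ.+ G) ℕ.+ g (a ℕ.+ suc d) ℕ.+ g a
      ≡⟨ cong (λ x → x ℕ.+ g (a ℕ.+ suc d) ℕ.+ g a) ih ⟩
    (sumY cs ℕ.+ G′ ℕ.+ g (b ℕ.+ 1) ℕ.+ g 1) ℕ.+ g (a ℕ.+ suc d) ℕ.+ g a
      ≡⟨ cong₂ (λ x y → (sumY cs ℕ.+ G′ ℕ.+ g x ℕ.+ g 1) ℕ.+ g (a ℕ.+ suc d) ℕ.+ g y) (ℕₚ.+-comm b 1)
        (sym (ℕₚ.m+n∸m≡n s a)) ⟩
    (sumY cs ℕ.+ G′ ℕ.+ g (suc b) ℕ.+ g 1) ℕ.+ g (a ℕ.+ suc d) ℕ.+ g (s ℕ.+ a ∸ s)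
      ≡⟨ lem₂ (sumY cs) G′ (g (suc b)) (g 1) (g (a ℕ.+ suc d)) (g (s ℕ.+ a ∸ s)) ⟩
    g (s ℕ.+ a ∸ s) ℕ.+ sumY cs ℕ.+ (g (suc b) ℕ.+ G′) ℕ.+ g (a ℕ.+ suc d) ℕ.+ g 1 ∎
    where
    open ≡-Reasoning
    s = suc (p ℕ.+ d)
    cs = corners (suc s) (b ∷ bs)
    X = sumX (suc s ℕ.+ suc (length bs)) cs s
    G = sum (map g (b ∷ bs))
    G′ = sum (map (g ∘ suc) bs)
    ih : X ℕ.+ G ≡ sumY cs ℕ.+ G′ ℕ.+ g (b ℕ.+ 1) ℕ.+ g 1
    ih = subst (λ m → sumX (suc m ℕ.+ suc (length bs)) (corners (suc m) (b ∷ bs)) s ℕ.+ G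
                   ≡ sumY (corners (suc m) (b ∷ bs)) ℕ.+ G′ ℕ.+ g (b ℕ.+ 1) ℕ.+ g 1)
           (ℕₚ.+-identityʳ s) (corners-sum s 0 bs b dec′)
    top : s ℕ.+ a ∸ p ≡ a ℕ.+ suc d
    top = trans (cong (_∸ p) (lem p d a)) (ℕₚ.m+n∸m≡n p (a ℕ.+ suc d))
      where
      lem : ∀ p d a → suc (p ℕ.+ d) ℕ.+ a ≡ p ℕ.+ (a ℕ.+ suc d)
      lem = ℕ-RingSolver.solve-∀
    lem : ∀ x y z w → x ℕ.+ y ℕ.+ (z ℕ.+ w) ≡ (y ℕ.+ w) ℕ.+ x ℕ.+ z
    lem = ℕ-RingSolver.solve-∀
    lem₂ : ∀ y g′ b o t a → (y ℕ.+ g′ ℕ.+ b ℕ.+ o) ℕ.+ t ℕ.+ a ≡ a ℕ.+ y ℕ.+ (b ℕ.+ g′) ℕ.+ t ℕ.+ o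
    lem₂ = ℕ-RingSolver.solve-∀
  ... | inj₂ refl rewrite corners-no (suc (p ℕ.+ d)) dec = begin
    sumX (s ℕ.+ suc (suc (length bs))) cs p ℕ.+ (g (suc b) ℕ.+ G)
      ≡⟨ cong (λ n → sumX n cs p ℕ.+ (g (suc b) ℕ.+ G)) (ℕₚ.+-suc s (suc (length bs))) ⟩
    X ℕ.+ (g (suc b) ℕ.+ G)
      ≡⟨ lem X (g (suc b)) G ⟩
    (X ℕ.+ G) ℕ.+ g (suc b)
      ≡⟨ cong (ℕ._+ g (suc b)) ih ⟩
    (sumY cs ℕ.+ G′ ℕ.+ g (b ℕ.+ suc (suc d)) ℕ.+ g 1) ℕ.+ g (suc b)
      ≡⟨ cong (λ x → (sumY cs ℕ.+ G′ ℕ.+ g x ℕ.+ g 1) ℕ.+ g (suc b)) (ℕₚ.+-suc b (suc d)) ⟩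
    (sumY cs ℕ.+ G′ ℕ.+ g (suc b ℕ.+ suc d) ℕ.+ g 1) ℕ.+ g (suc b)
      ≡⟨ lem₂ (sumY cs) G′ (g (suc b ℕ.+ suc d)) (g 1) (g (suc b)) ⟩
    sumY cs ℕ.+ (g (suc b) ℕ.+ G′) ℕ.+ g (suc b ℕ.+ suc d) ℕ.+ g 1 ∎
    where
    open ≡-Reasoning
    s = suc (p ℕ.+ d)
    cs = corners (suc s) (b ∷ bs)
    X = sumX (suc s ℕ.+ suc (length bs)) cs p
    G = sum (map g (b ∷ bs))
    G′ = sum (map (g ∘ suc) bs)
    ih : X ℕ.+ G ≡ sumY cs ℕ.+ G′ ℕ.+ g (b ℕ.+ suc (suc d)) ℕ.+ g 1
    ih = subst (λ m → sumX (suc m ℕ.+ suc (length bs)) (corners (suc m) (b ∷ bs)) p ℕ.+ G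
                   ≡ sumY (corners (suc m) (b ∷ bs)) ℕ.+ G′ ℕ.+ g (b ℕ.+ suc (suc d)) ℕ.+ g 1)
           (ℕₚ.+-suc p d) (corners-sum p (suc d) bs b dec′)
    lem : ∀ x y z → x ℕ.+ (y ℕ.+ z) ≡ (x ℕ.+ z) ℕ.+ y
    lem = ℕ-RingSolver.solve-∀
    lem₂ : ∀ y g′ t o b → (y ℕ.+ g′ ℕ.+ t ℕ.+ o) ℕ.+ b ≡ y ℕ.+ (b ℕ.+ g′) ℕ.+ t ℕ.+ o
    lem₂ = ℕ-RingSolver.solve-∀

  zipWith-∷ʳ : ∀ (f : ℕ → ℕ → ℕ) us vs u v → length us ≡ length vs →
    zipWith f (us ++ u ∷ []) (vs ++ v ∷ []) ≡ zipWith f us vs ++ f u v ∷ []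
  zipWith-∷ʳ f []       []       u v _  = refl
  zipWith-∷ʳ f (x ∷ us) (y ∷ vs) u v eq = cong (f x y ∷_) (zipWith-∷ʳ f us vs u v (ℕₚ.suc-injective eq))

  sumX-reverse : ∀ n cs p →
    sum (map g (zipWith _∸_ (n ∷ map proj₂ (reverse cs)) (map proj₁ (reverse cs) ++ p ∷ [])))
      ≡ sumX n cs p
  sumX-reverse n []                  p = ℕₚ.+-identityʳ (g (n ∸ p))
  sumX-reverse n (c@(α , β) ∷ cs) p
    rewrite unfold-reverse c cs | map-++ proj₂ (reverse cs) (c ∷ []) | map-++ proj₁ (reverse cs)
      (c ∷ [])
          | zipWith-∷ʳ _∸_ (n ∷ map proj₂ (reverse cs)) (map proj₁ (reverse cs) ++ α ∷ []) β p
              (trans (cong suc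
                (trans (length-map proj₂ (reverse cs)) (sym (length-map proj₁ (reverse cs)))))
                     (trans (ℕₚ.+-comm 1 _) (sym (length-++ (map proj₁ (reverse cs))))))
          | map-++ g (zipWith _∸_ (n ∷ map proj₂ (reverse cs)) (map proj₁ (reverse cs) ++ α ∷ [])) (β ∸ p ∷ [])
          | sum-++ (map g (zipWith _∸_ (n ∷ map proj₂ (reverse cs)) (map proj₁ (reverse cs) ++ α ∷ []))) (g (β ∸ p) ∷ [])
          | sumX-reverse n cs α = trans (cong (sumX n cs α ℕ.+_) (ℕₚ.+-identityʳ _)) (ℕₚ.+-comm (sumX n cs α) _)

  sumX-xs : ∀ lam → sum (map g (xs lam)) ≡ sumX (suc (ℓ lam)) (corners 1 (parts lam)) 0
  sumX-xs lam = sumX-reverse (suc (ℓ lam)) (corners 1 (parts lam)) 0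

  sumY-ys : ∀ lam → sum (map g (ys lam)) ≡ sumY (corners 1 (parts lam))
  sumY-ys lam = trans (cong sum (sym (map-∘ (outerCorners lam))))
    (sum-↭ (map⁺ _ (↭-reverse (corners 1 (parts lam)))))

  -- Kept free of subtraction, and for arbitrary g, so that it is an identity of natural numbers.
  -- The last row always ends in an outer corner, hence x_0 = 1 and the extra `g 1`; this also
  -- covers the empty partition. For g x = C(x, 2) ^ k with k ≥ 1 the term `g 1` is 0.
  xs-ys : ∀ lam → sum (map g (xs lam)) ℕ.+ sum (map g (parts lam))
                ≡ sum (map g (ys lam)) ℕ.+ sum (map (g ∘ suc) (parts lam)) ℕ.+ g 1
  xs-ys lam = trans (cong (ℕ._+ sum (map g (parts lam))) (sumX-xs lam))
    (trans (go (parts lam) (decreasing (isStrict lam)))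
      (cong (λ y → y ℕ.+ sum (map (g ∘ suc) (parts lam)) ℕ.+ g 1) (sym (sumY-ys lam))))
    where
    go : ∀ as → Decreasing as → sumX (suc (length as)) (corners 1 as) 0 ℕ.+ sum (map g as)
       ≡ sumY (corners 1 as) ℕ.+ sum (map (g ∘ suc) as) ℕ.+ g 1
    go []       _   = ℕₚ.+-identityʳ (g 1)
    go (a ∷ as) dec = trans (corners-sum 0 0 as a dec)
      (trans (cong (λ x → sumY cs ℕ.+ G ℕ.+ g x ℕ.+ g 1) (ℕₚ.+-comm a 1)) (lem (sumY cs) G (g (suc a))
        (g 1)))
      where
      cs = corners 1 (a ∷ as)
      G = sum (map (g ∘ suc) as)
      lem : ∀ y g′ t o → y ℕ.+ g′ ℕ.+ t ℕ.+ o ≡ y ℕ.+ (t ℕ.+ g′) ℕ.+ o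
      lem = ℕ-RingSolver.solve-∀

q-powersum : ∀ k lam → 0 ℕ.< k → ι (q k lam) ≡ powersum (parts lam) k
q-powersum (suc k) lam _ = begin
  ι (ℤ.+ X ℤ.- ℤ.+ Y)       ≡⟨ trans (ι-+ (ℤ.+ X) (ℤ.- (ℤ.+ Y))) (cong (ι (ℤ.+ X) +_) (ι-neg (ℤ.+ Y))) ⟩
  ι (ℤ.+ X) - ι (ℤ.+ Y)     ≡⟨ cong₂ _-_ (ι≡fromℕ X) (ι≡fromℕ Y) ⟩
  fromℕ X - fromℕ Y         ≡⟨ lem₁ (fromℕ X) (fromℕ Y) (fromℕ U) (fromℕ V) ⟩
  (fromℕ X + fromℕ U) - (fromℕ Y + fromℕ V + 0ℚ) + (fromℕ V - fromℕ U)
    ≡⟨ cong (λ w → w - (fromℕ Y + fromℕ V + 0ℚ) + (fromℕ V - fromℕ U)) eq ⟩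
  (fromℕ Y + fromℕ V + 0ℚ) - (fromℕ Y + fromℕ V + 0ℚ) + (fromℕ V - fromℕ U)
    ≡⟨ lem₂ (fromℕ Y + fromℕ V + 0ℚ) (fromℕ V - fromℕ U) ⟩
  fromℕ V - fromℕ U         ≡⟨ sums (parts lam) ⟩
  powersum (parts lam) (suc k) ∎
  where
  open ≡-Reasoning
  g : ℕ → ℕ
  g x = (x C 2) ℕ.^ suc k
  X = sum (map g (xs lam))
  Y = sum (map g (ys lam))
  U = sum (map g (parts lam))
  V = sum (map (g ∘ suc) (parts lam))
  eq : fromℕ X + fromℕ U ≡ fromℕ Y + fromℕ V + 0ℚ
  eq = trans (sym (fromℕ-+ X U)) (trans (cong fromℕ (xs-ys g lam))
    (trans (fromℕ-+ (Y ℕ.+ V) (g 1)) (cong₂ _+_ (fromℕ-+ Y V) fromℕ-0)))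
  lem₁ : ∀ x y u v → x - y ≡ (x + u) - (y + v + 0ℚ) + (v - u)
  lem₁ = solve-∀ ring
  lem₂ : ∀ x y → x - x + y ≡ y
  lem₂ = solve-∀ ring
  fromℕ-g : ∀ a → fromℕ (g a) ≡ t a ^ suc k
  fromℕ-g a = trans (fromℕ-^ (a C 2) (suc k)) (cong (_^ suc k) (sym (t≡ a)))
  sums : ∀ as → fromℕ (sum (map (g ∘ suc) as)) - fromℕ (sum (map g as)) ≡ powersum as (suc k)
  sums []       = cong₂ _-_ fromℕ-0 fromℕ-0
  sums (a ∷ as) = trans (cong₂ _-_ (fromℕ-+ (g (suc a)) _) (fromℕ-+ (g a) _))
    (trans (lem (fromℕ (g (suc a))) (fromℕ (sum (map (g ∘ suc) as))) (fromℕ (g a)) (fromℕ (sum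
      (map g as))))
      (cong₂ _+_ (cong₂ _-_ (fromℕ-g (suc a)) (fromℕ-g a)) (sums as)))
    where
    lem : ∀ x y u v → (x + y) - (u + v) ≡ (x - u) + (y - v)
    lem = solve-∀ ring

-- Adding a box, and D as a sum over all rows

powersum-inc : ∀ {as b bs} → Increment as b bs → ∀ k → powersum bs k ≡ powersum as k + Δ k b
-- As z 0 = t 0 = 0, a new part 1 changes the power sum exactly as the growth of a part 0 would.
powersum-inc new k = trans (lem (z 1 ^ k) (z 0 ^ k))
  (cong (λ x → 0ℚ + ((z 1 ^ k - z 0 ^ k) - (z 0 ^ k - x ^ k))) (trans z-0 (sym (trans (t≡ 0) fromℕ-0))))
  where
  lem : ∀ x y → (x - y) + 0ℚ ≡ 0ℚ + ((x - y) - (y - y))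
  lem = solve-∀ ring
powersum-inc {a ∷ as} here k = lem (z (suc a) ^ k) (z a ^ k) (t a ^ k) (powersum as k)
  where
  lem : ∀ x y w p → (x - y) + p ≡ ((y - w) + p) + ((x - y) - (y - w))
  lem = solve-∀ ring
powersum-inc {a ∷ as} {b} (there inc) k = trans (cong (z a ^ k - t a ^ k +_) (powersum-inc inc k))
  (sym (+-assoc (z a ^ k - t a ^ k) (powersum as k) (Δ k b)))

psprod-inc : ∀ {as b bs} → Increment as b bs → ∀ ks → psprod ks bs ≡ psprodΔ ks as b
psprod-inc inc []       = refl
psprod-inc inc (k ∷ ks) = cong₂ _*_ (powersum-inc inc k) (psprod-inc inc ks)

increment-head : ∀ {a as b c cs} → 0 ℕ.< a → All (ℕ._< a) as → Increment as b (c ∷ cs) → c ℕ.≤ a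
increment-head 0<a []        new       = 0<a
increment-head 0<a (p ∷ _) here      = p
increment-head 0<a (p ∷ _) (there _) = ℕₚ.<⇒≤ p

-- Strictness can fail only when the enlarged part reaches the part above it, and then the factor a
-- - a of the inverse hook product is 0. This lets D be summed over all rows.
increment-strict : ∀ {as b bs} → Decreasing as → Increment as b bs → IsStrict bs ⊎ hookInv bs ≡ 0ℚ
increment-strict dec new = inj₁ ([-] , ℕ.s≤s ℕ.z≤n ∷ [])
increment-strict (cons 0<a as<a dec) here =
  inj₁ (strict (cons (ℕ.s≤s ℕ.z≤n) (All.map ℕₚ.m<n⇒m<1+n as<a) dec))
increment-strict {a ∷ as} (cons 0<a as<a dec) (there {bs = bs} inc) with increment-strict dec inc
... | inj₂ zero-bs = inj₂ (trans (cong (rowInv a bs *_) zero-bs) (*-zeroʳ (rowInv a bs)))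
increment-strict {a ∷ as} (cons 0<a as<a dec) (there {bs = []} inc) | inj₁ _ = inj₁ ([-] , 0<a ∷ [])
increment-strict {a ∷ as} (cons 0<a as<a dec) (there {bs = c ∷ cs} inc) | inj₁ (l , pos)
  with ℕₚ.m≤n⇒m<n∨m≡n (increment-head 0<a as<a inc)
... | inj₁ c<a  = inj₁ (c<a ∷ l , 0<a ∷ pos)
... | inj₂ refl =
  inj₂ (trans
    (cong (λ x → rowInv a cs * (x * inv (fromℕ a + fromℕ a)) * hookInv (a ∷ cs)) (+-inverseʳ (fromℕ a)))
                    (lem (rowInv a cs) (inv (fromℕ a + fromℕ a)) (hookInv (a ∷ cs))))
  where
  lem : ∀ r i h → r * (0ℚ * i) * h ≡ 0ℚ
  lem = solve-∀ ring

increment-additions : ∀ as → All (λ bs → ∃ λ b → Increment as b bs) (additions as)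
increment-additions []       = (0 , new) ∷ []
increment-additions (a ∷ as) =
  (a , here) ∷ Allₚ.map⁺ (All.map (λ (b , inc) → b , there inc) (increment-additions as))

sumℚ-strict : ∀ {P : ℕ → Set} (P? : Decidable P) (G : StrictPartition → ℚ) (g : List ℕ → ℚ) →
  (∀ μ → G μ ≡ g (parts μ)) → ∀ {L} → All (λ bs → IsStrict bs ⊎ g bs ≡ 0ℚ) L →
  sumℚ (map G (filter (P? ∘ ℓ) (mapMaybe strictPartition? L))) ≡ sumℚ (map g (filter (P? ∘ length) L))
sumℚ-strict P? G g h [] = refl
sumℚ-strict P? G g h {bs ∷ L} (v ∷ vs) with isStrict? bs
sumℚ-strict P? G g h {bs ∷ L} (v ∷ vs) | yes s with P? (length bs)
... | yes _ = cong₂ _+_ (h (mkStrict bs s)) (sumℚ-strict P? G g h vs)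
... | no _  = sumℚ-strict P? G g h vs
sumℚ-strict P? G g h {bs ∷ L} (inj₁ s ∷ vs) | no ¬s = contradiction s ¬s
sumℚ-strict P? G g h {bs ∷ L} (inj₂ g≡0 ∷ vs) | no ¬s with P? (length bs)
... | yes _ = trans (sumℚ-strict P? G g h vs) (sym (trans (cong (_+ rest) g≡0) (+-identityˡ rest)))
  where rest = sumℚ (map g (filter (P? ∘ length) L))
... | no _  = sumℚ-strict P? G g h vs

sumℚ-filter-map : ∀ {P Q : List ℕ → Set} (P? : Decidable P) (Q? : Decidable Q) (g : List ℕ → ℚ) h →
  (∀ x → P (h x) ⇔ Q x) → ∀ L → sumℚ (map g (filter P? (map h L))) ≡ sumℚ (map (g ∘ h) (filter Q? L))
sumℚ-filter-map P? Q? g h P⇔Q []      = refl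
sumℚ-filter-map P? Q? g h P⇔Q (x ∷ L) with P? (h x) | Q? x
... | yes _ | yes _ = cong (g (h x) +_) (sumℚ-filter-map P? Q? g h P⇔Q L)
... | no _  | no _  = sumℚ-filter-map P? Q? g h P⇔Q L
... | yes p | no ¬q = contradiction (Equivalence.to (P⇔Q x) p) ¬q
... | no ¬p | yes q = contradiction (Equivalence.from (P⇔Q x) q) ¬p

additions-addSum : ∀ as g →
  sumℚ (map g (filter ((ℕₚ._>? length as) ∘ length) (additions as)))
    + 2ℚ * sumℚ (map g (filter ((ℕₚ._≟ length as) ∘ length) (additions as))) ≡ addSum (λ _ → g) as
additions-addSum []       g = lem (g (1 ∷ []))
  where
  lem : ∀ x → x + 0ℚ + 2ℚ * 0ℚ ≡ x
  lem x = trans (cong₂ _+_ (+-identityʳ x) (*-zeroʳ 2ℚ)) (+-identityʳ x)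
additions-addSum (a ∷ as) g = begin
  sumℚ (map g (filter longer? (new-head ∷ map (a ∷_) L))) + 2ℚ * sumℚ (map g (filter same?
    (new-head ∷ map (a ∷_) L)))
    ≡⟨ cong₂ (λ x y → sumℚ (map g x) + 2ℚ * sumℚ (map g y))
         (filter-reject longer? {new-head} {map (a ∷_) L} (ℕₚ.<-irrefl refl))
           (filter-accept same? {new-head} {map (a ∷_) L} refl) ⟩
  sumℚ (map g (filter longer? (map (a ∷_) L))) + 2ℚ * (g new-head + sumℚ (map g (filter same? (map
    (a ∷_) L))))
    ≡⟨ cong₂ (λ x y → x + 2ℚ * (g new-head + y))
         (sumℚ-filter-map longer? ((ℕₚ._>? length as) ∘ length) g (a ∷_) (λ _ → mk⇔ ℕₚ.≤-pred ℕ.s≤s) L)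
         (sumℚ-filter-map same? ((ℕₚ._≟ length as) ∘ length) g (a ∷_) (λ _ → mk⇔ ℕₚ.suc-injective
           (cong suc)) L) ⟩
  X + 2ℚ * (g new-head + Y)
    ≡⟨ lem X Y (g new-head) 2ℚ ⟩
  2ℚ * g new-head + (X + 2ℚ * Y)
    ≡⟨ cong (2ℚ * g new-head +_) (additions-addSum as (g ∘ (a ∷_))) ⟩
  2ℚ * g new-head + addSum (λ _ bs → g (a ∷ bs)) as ∎
  where
  open ≡-Reasoning
  new-head = suc a ∷ as
  L = additions as
  longer? = (ℕₚ._>? suc (length as)) ∘ length {A = ℕ}
  same? = (ℕₚ._≟ suc (length as)) ∘ length {A = ℕ}
  X = sumℚ (map (g ∘ (a ∷_)) (filter ((ℕₚ._>? length as) ∘ length) L))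
  Y = sumℚ (map (g ∘ (a ∷_)) (filter ((ℕₚ._≟ length as) ∘ length) L))
  lem : ∀ x y n k → x + k * (n + y) ≡ k * n + (x + k * y)
  lem = solve-∀ ring

D-addSum : ∀ (G : StrictPartition → ℚ) g lam → (∀ μ → G μ ≡ g (parts μ)) →
  (∀ {bs} → (∃ λ b → Increment (parts lam) b bs) → IsStrict bs ⊎ g bs ≡ 0ℚ) →
  D G lam ≡ addSum (λ _ → g) (parts lam) - g (parts lam)
D-addSum G g lam h v = cong₂ _-_
  (trans (cong₂ (λ x y → x + 2ℚ * y) (sumℚ-strict (ℕₚ._>? ℓ lam) G g h valid) (sumℚ-strict
    (ℕₚ._≟ ℓ lam) G g h valid))
    (additions-addSum (parts lam) g))
  (h lam)
  where
  valid = All.map v (increment-additions (parts lam))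

qᵖ-psprod : ∀ ν lam → ι (qᵖ ν lam) ≡ psprod (partsᵖ ν) (parts lam)
qᵖ-psprod (mkPartition ks (_ , pos)) lam = go pos
  where
  go : ∀ {ks} → All (0 ℕ.<_) ks → ι (productℤ (map (λ k → q k lam) ks)) ≡ psprod ks (parts lam)
  go [] = refl
  go {k ∷ ks} (0<k ∷ pos) = trans (ι-* (q k lam) (productℤ (map (λ k → q k lam) ks)))
    (cong₂ _*_ (q-powersum k lam 0<k) (go pos))

D-psprod : ∀ ν lam → let as = parts lam; ks = partsᵖ ν in
  D (λ μ → qᵖ ν μ /H μ) lam ≡ E as (λ b → 1ℚ * (psprodΔ ks as b - psprod ks as)) * hookInv as
D-psprod ν lam = begin
  D (λ μ → qᵖ ν μ /H μ) lam
    ≡⟨ D-addSum (λ μ → qᵖ ν μ /H μ) g lam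
         (λ μ → trans (/H-hookInv (qᵖ ν μ) μ) (cong (_* hookInv (parts μ)) (qᵖ-psprod ν μ)))
         (λ {bs} (b , inc) → [ inj₁ , (λ eq → inj₂
           (trans (cong (psprod ks bs *_) eq) (*-zeroʳ (psprod ks bs)))) ]′
            (increment-strict dec inc)) ⟩
  addSum (λ _ bs → psprod ks bs * hookInv bs) as - psprod ks as * hookInv as
    ≡⟨ cong (_- psprod ks as * hookInv as)
         (trans (addSum-cong as λ {b} {bs} inc → cong (_* hookInv bs) (psprod-inc inc ks))
           (addSum-hookInv dec (psprodΔ ks as))) ⟩
  hookInv as * E as (psprodΔ ks as) - psprod ks as * hookInv as
    ≡⟨ lem (hookInv as) (E as (psprodΔ ks as)) (psprod ks as) ⟩
  (1ℚ * E as (psprodΔ ks as) + (- psprod ks as) * 1ℚ) * hookInv as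
    -- The weights sum to 1, so the subtracted value at λ itself can be moved inside `E`.
    ≡⟨ cong (λ x → (1ℚ * E as (psprodΔ ks as) + (- psprod ks as) * x) * hookInv as) (moment-0 dec) ⟨
  (1ℚ * E as (psprodΔ ks as) + (- psprod ks as) * E as (λ _ → 1ℚ)) * hookInv as
    ≡⟨ cong (_* hookInv as) (E-linear as 1ℚ (- psprod ks as) (psprodΔ ks as) (λ _ → 1ℚ)) ⟨
  E as (λ b → 1ℚ * psprodΔ ks as b + (- psprod ks as) * 1ℚ) * hookInv as
    ≡⟨ cong (_* hookInv as) (E-ext as λ b → lem₂ (psprodΔ ks as b) (psprod ks as)) ⟩
  E as (λ b → 1ℚ * (psprodΔ ks as b - psprod ks as)) * hookInv as ∎
  where
  open ≡-Reasoning
  as = parts lam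
  ks = partsᵖ ν
  dec = decreasing (isStrict lam)
  g : List ℕ → ℚ
  g as = psprod ks as * hookInv as
  lem : ∀ h e p → h * e - p * h ≡ (1ℚ * e + (- p) * 1ℚ) * h
  lem = solve-∀ ring
  lem₂ : ∀ x p → 1ℚ * x + (- p) * 1ℚ ≡ 1ℚ * (x - p)
  lem₂ = solve-∀ ring

-- Reading off the coefficients

sumℚ-cong : ∀ {A : Set} {f g : A → ℚ} L → (∀ x → f x ≡ g x) → sumℚ (map f L) ≡ sumℚ (map g L)
sumℚ-cong L h = cong sumℚ (map-cong h L)

sumℚ-+ : ∀ {A : Set} (f g : A → ℚ) L → sumℚ (map (λ x → f x + g x) L) ≡ sumℚ (map f L) + sumℚ (map g L)
sumℚ-+ f g []      = refl
sumℚ-+ f g (x ∷ L) =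
  trans (cong (f x + g x +_) (sumℚ-+ f g L)) (lem (f x) (g x) (sumℚ (map f L)) (sumℚ (map g L)))
  where
  lem : ∀ a b c d → a + b + (c + d) ≡ a + c + (b + d)
  lem = solve-∀ ring

sumℚ-zero : ∀ {A : Set} {f : A → ℚ} {L} → All (λ x → f x ≡ 0ℚ) L → sumℚ (map f L) ≡ 0ℚ
sumℚ-zero [] = refl
sumℚ-zero (p ∷ ps) = cong₂ _+_ p (sumℚ-zero ps)

sumℚ-single : ∀ {A : Set} (f : A → ℚ) {x L} → Unique L → x ∈ L → (∀ y → x ≢ y → f y
  ≡ 0ℚ) → sumℚ (map f L) ≡ f x
sumℚ-single f {x} {_ ∷ L} (x∉ ∷ u) (here refl) h =
  trans (cong (f x +_) (sumℚ-zero (All.map (h _) x∉))) (+-identityʳ (f x))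
sumℚ-single f {x} {y ∷ L} (y∉ ∷ u) (there x∈) h =
  trans (cong₂ _+_ (h y (λ eq → All.lookup y∉ x∈ (sym eq))) (sumℚ-single f u x∈ h)) (+-identityˡ (f x))

partsᵖ-injective : ∀ {δ ε} → partsᵖ δ ≡ partsᵖ ε → δ ≡ ε
partsᵖ-injective {mkPartition ks p} {mkPartition .ks p′} refl =
  cong (mkPartition ks) (Adequacy.part-irr p p′)

psprod-↭ : ∀ {ks ls} → ks ↭ ls → ∀ as → psprod ks as ≡ psprod ls as
psprod-↭ Perm.refl         as = refl
psprod-↭ (Perm.prep k p)   as = cong (powersum as k *_) (psprod-↭ p as)
psprod-↭ {ls =
  _ ∷ _ ∷ ls} (Perm.swap k l p) as =
    trans (cong (λ x → powersum as k * (powersum as l * x)) (psprod-↭ p as))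
  (lem (powersum as k) (powersum as l) (psprod ls as))
  where
  lem : ∀ x y w → x * (y * w) ≡ y * (x * w)
  lem = solve-∀ ring
psprod-↭ (Perm.trans p p′) as = trans (psprod-↭ p as) (psprod-↭ p′ as)

open Data.List.Sort (Flip.decTotalOrder ℕₚ.≤-decTotalOrder) using (sort; sort-↭; sort-↗)

toPartition : ∀ ks → All (0 ℕ.<_) ks → Partition
toPartition ks pos = mkPartition (sort ks) (sort-↗ ks , All-resp-↭ (↭-sym (sort-↭ ks)) pos)

-- A monomial does not depend on the order of its indices, so its coefficient is placed at the
-- sorted index list and 0 everywhere else. The list `partitionsBelow n` has no repetitions, hence
-- the sum collapses to that one term. Sums of certificates add their coefficients.
expand : ∀ {n F} → Poly n F → Σ[ ξ ∈ (Partition → ℚ) ] ((lam : StrictPartition) →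
  F (parts lam) * hookInv (parts lam) ≡ sumℚ (map (λ δ → ξ δ * (qᵖ δ lam /H lam)) (partitionsBelow n)))
expand {n} null = (λ _ → 0ℚ) , λ lam → trans (*-zeroˡ (hookInv (parts lam)))
  (sym (sumℚ-zero (All.universal (λ δ → *-zeroˡ (qᵖ δ lam /H lam)) (partitionsBelow n))))
expand {n} (mono c {ks} pos lt) = ξ , λ lam → sym (begin
  sumℚ (map (λ δ → ξ δ * (qᵖ δ lam /H lam)) (partitionsBelow n))
    ≡⟨ sumℚ-single _ (Adequacy.partitionsBelow-unique n) ε∈
         (λ δ ε≢δ → trans (cong (_* (qᵖ δ lam /H lam)) (ξ-≢ δ ε≢δ)) (*-zeroˡ (qᵖ δ lam /H lam))) ⟩
  ξ ε * (qᵖ ε lam /H lam)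
    ≡⟨ cong₂ _*_ ξ-ε (trans (/H-hookInv (qᵖ ε lam) lam) (cong (_* hookInv (parts lam))
         (trans (qᵖ-psprod ε lam) (psprod-↭ (sort-↭ ks) (parts lam))))) ⟩
  c * (psprod ks (parts lam) * hookInv (parts lam))
    ≡⟨ *-assoc c (psprod ks (parts lam)) (hookInv (parts lam)) ⟨
  c * psprod ks (parts lam) * hookInv (parts lam) ∎)
  where
  open ≡-Reasoning
  ε = toPartition ks pos
  ε∈ : ε ∈ partitionsBelow n
  ε∈ = Equivalence.from Adequacy.partitionsBelow⇔ (subst (ℕ._< n) (sym (sum-↭ (sort-↭ ks))) lt)
  ε≟ : ∀ δ → Dec (partsᵖ ε ≡ partsᵖ δ)
  ε≟ δ = ≡-dec ℕₚ._≟_ (partsᵖ ε) (partsᵖ δ)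
  ξ : Partition → ℚ
  ξ δ = if does (ε≟ δ) then c else 0ℚ
  ξ-ε : ξ ε ≡ c
  ξ-ε = cong (λ d → if d then c else 0ℚ) (dec-true (ε≟ ε) refl)
  ξ-≢ : ∀ δ → ε ≢ δ → ξ δ ≡ 0ℚ
  ξ-≢ δ ε≢δ = cong (λ d → if d then c else 0ℚ) (dec-false (ε≟ δ) (ε≢δ ∘ partsᵖ-injective))
expand {n} (_⊕_ {F} {G} P Q) with expand P | expand Q
... | ξ , hξ | η , hη = (λ δ → ξ δ + η δ) , λ lam →
  trans (*-distribʳ-+ (hookInv (parts lam)) (F (parts lam)) (G (parts lam)))
    (trans (cong₂ _+_ (hξ lam) (hη lam))
      (sym (trans (sumℚ-cong (partitionsBelow n) (λ δ → *-distribʳ-+ (qᵖ δ lam /H lam) (ξ δ) (η δ)))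
        (sumℚ-+ (λ δ → ξ δ * (qᵖ δ lam /H lam)) (λ δ → η δ * (qᵖ δ lam /H lam)) (partitionsBelow n)))))
expand (resp h P) with expand P
... | ξ , hξ =
  ξ , λ lam → trans (cong (_* hookInv (parts lam)) (sym (h (decreasing (isStrict lam))))) (hξ lam)

theorem3p6 : (ν : Partition) →
    Σ[ ξ ∈ (Partition → ℚ) ] ((lam : StrictPartition) →
    D (λ μ → qᵖ ν μ /H μ) lam
    ≡ sumℚ (map (λ δ → ξ δ * (qᵖ δ lam /H lam)) (partitionsBelow ∣ ν ∣ᵖ)))
-- The multiplier is the constant 1, of degree below 1, so the weight bound of `E-psprodΔ` is
-- exactly |ν|; for the empty ν it is 0 and the sum is empty.
theorem3p6 ν with expand (E-psprodΔ (proj₂ (isPartition ν)) (mono {1} 1ℚ {0} (ℕ.s≤s ℕ.z≤n)))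
... | ξ , hξ = ξ , λ lam → trans (D-psprod ν lam) (hξ lam)
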